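{- Let $G(V,E)$ be a finite simple graph with $|V|>3$. If $G(V,E)$ is minimally $3$-rigid, then for every edge $e\in E$ there exists a partition of $E$ into three pairwise disjoint sets $S_1,S_2,S_3$ (so $E=S_1\cup S_2\cup S_3$) such that $|S_i|=|V|-i$ for $i=1,2,3$ and the three graphs $G(V,S_1\cup S_2)$, $G(V,S_1\cup S_3)/e$ and $G(V,S_2\cup S_3)/e$ are all minimally $2$-rigid.
   Context: For a graph $G(V,E)$, place the vertices at points of $\mathbb{R}^d$ by a generic map $\vec{p}:V\to\mathbb{R}^d$ (e.g. with all coordinates algebraically independent over $\mathbb{Q}$), put a ball joint at each point and a rigid bar between the endpoints of each edge. $G$ is (generically) $d$-rigid if this bar-and-joint framework is rigid in $\mathbb{R}^d$; this depends only on $G$. $G$ is minimally $d$-rigid if it is $d$-rigid and has the minimal number of edges among $d$-rigid graphs on its vertex set. Equivalently (for $|V|>d$), $|E|=d|V|-\binom{d+1}{2}$ and the rigidity matrix $\vec{M}(G,d)$ has full row rank $|E|$. Here $\vec{M}(G,d)$ has one row per edge and $d|V|$ columns indexed by pairs (direction $i$, vertex); the row of an edge $v_jv_k$ has, in the block of direction $i$, entry $p_i^k-p_i^j$ in the column of $v_j$ and $p_i^j-p_i^k$ in the column of $v_k$, all other entries being zero, where $p_i^j$ is the $i$-th coordinate of $\vec{p}(v_j)$. For graphs with parallel edges the same definition is used, each parallel edge contributing its own row and being counted in $|E|$. For $S\subseteq E$, $G(V,S)$ denotes the graph with vertex set $V$ and edge set $S$. For an edge $e\in E$ with endpoints $u,v$,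 the notation $G(V,S)/e$ means: if $e\in S$, contract $e$ (delete $e$ and identify $u$ with $v$); if $e\notin S$, just identify the vertices $u$ and $v$. All other edges are kept (with multiplicity), so the result has $|V|-1$ vertices. -}

module Defs where

open import Data.Bool using (if_then_else_)
open import Data.Fin using (Fin; combine; punchOut)
import Data.Fin as Fin
open import Data.Fin.Subset using (Subset; _∈_; _∉_; _⊆_; _-_; ∣_∣)
open import Data.List using (List; []; _∷_; _++_; map; cartesianProductWith)
open import Data.Nat using (ℕ; suc; _*_; _∸_; _≤_)
import Data.Nat as ℕ
open import Data.Nat.Combinatorics using (_C_)
open import Data.Product using (Σ-syntax; _×_; _,_; proj₁; proj₂)
open import Data.Rational using (ℚ; 0ℚ; 1ℚ)
import Data.Rational as ℚ
open import Data.Sum using (_⊎_)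
open import Data.Vec using (Vec; replicate; zipWith; _[_]≔_)
open import Data.Vec.Functional using (foldr)
open import Data.Vec.Properties using (≡-dec)
open import Relation.Binary.PropositionalEquality using (_≡_; _≢_)
open import Relation.Nullary using (does; yes; no)

-- The polynomial ring ℚ[x₀,…,x_{k-1}].  A polynomial is a formal sum of terms
-- (coefficient , exponent vector), in which an exponent may be repeated or have
-- coefficient 0; two polynomials are equal when all their coefficients agree.

Monomial : ℕ → Set
Monomial k = Vec ℕ k

Poly : ℕ → Set
Poly k = List (ℚ × Monomial k)

private
  variable
    k n m : ℕ

coeff : Poly k → Monomial k → ℚ
coeff []            α = 0ℚ
coeff ((a , β) ∷ p) α =
  (if does (≡-dec ℕ._≟_ β α) then a else 0ℚ) ℚ.+ coeff p α

infix 4 _≈ₚ_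
_≈ₚ_ : Poly k → Poly k → Set
p ≈ₚ q = ∀ α → coeff p α ≡ coeff q α

0ₚ : Poly k
0ₚ = []

var : Fin k → Poly k
var i = (1ℚ , replicate _ 0 [ i ]≔ 1) ∷ []

infixl 6 _+ₚ_ _-ₚ_
infixl 7 _*ₚ_

_+ₚ_ : Poly k → Poly k → Poly k
p +ₚ q = p ++ q

-ₚ_ : Poly k → Poly k
-ₚ_ = map (λ (a , α) → ℚ.- a , α)

_-ₚ_ : Poly k → Poly k → Poly k
p -ₚ q = p +ₚ (-ₚ q)

_*ₚ_ : Poly k → Poly k → Poly k
_*ₚ_ = cartesianProductWith λ (a , α) (b , β) → a ℚ.* b , zipWith ℕ._+_ α β

∑ : (Fin m → Poly k) → Poly k
∑ = foldr _+ₚ_ 0ₚ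

-- Multigraphs on the vertex set Fin n.  Edges carry labels from Fin m, and
-- `edges` is the set of labels actually present, so that passing to a subgraph
-- or a contraction does not relabel edges.  Edges are undirected: the order of
-- the two components of `ends` plays no role.

record Graph (n m : ℕ) : Set where
  constructor graph
  field
    ends  : Fin m → Fin n × Fin n
    edges : Subset m

open Graph public

SameEnds : Fin n × Fin n → Fin n × Fin n → Set
SameEnds (a , b) (c , d) = (a ≡ c × b ≡ d) ⊎ (a ≡ d × b ≡ c)

record Simple (G : Graph n m) : Set where
  field
    loopless   : ∀ {e} → e ∈ edges G → proj₁ (ends G e) ≢ proj₂ (ends G e)
    noParallel : ∀ {e f} → e ∈ edges G → f ∈ edges G →
                 SameEnds (ends G e) (ends G f) → e ≡ f

open Simple public

-- G(V,S)
spanning : Graph n m → Subset m → Graph n m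
spanning G S = record G { edges = S }

-- The quotient map of the vertex set that identifies v with u.
identify : (u v : Fin (suc n)) → v ≢ u → Fin (suc n) → Fin n
identify u v v≢u w with v Fin.≟ w
... | yes _  = punchOut v≢u
... | no v≢w = punchOut v≢w

-- G/e: the ends of e are identified and e is deleted if it is present.  The
-- label e need not be in `edges G`.
contract : (G : Graph (suc n) m) (e : Fin m) →
           proj₂ (ends G e) ≢ proj₁ (ends G e) → Graph n m
contract G e v≢u = graph (λ f → let (a , b) = ends G f in q a , q b) (edges G - e)
  where q = identify (proj₁ (ends G e)) (proj₂ (ends G e)) v≢u

-- The generic placement Fin n → (point with d coordinates): the coordinates are
-- distinct indeterminates.  For coordinates in ℝ that are algebraically
-- independent over ℚ, the subring they generate over ℚ is this polynomial ring.
coord : (d n : ℕ) → Fin d → Fin n → Poly (d * n)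
coord d n i v = var (combine i v)

rigidityMatrix : (d : ℕ) → Graph n m → Fin m → Fin d → Fin n → Poly (d * n)
rigidityMatrix {n} d G e i v =
  let (a , b) = ends G e
      p       = coord d n i
  in if does (v Fin.≟ a) then p b -ₚ p a
     else if does (v Fin.≟ b) then p a -ₚ p b
     else 0ₚ

-- Linear independence of the rows labelled by T.  Clearing denominators,
-- independence over ℚ[x] is the same as independence over its field of
-- fractions, so `HasRank` below is the rank over that field.
IndependentRows : (d : ℕ) → Graph n m → Subset m → Set
IndependentRows {n} {m} d G T =
  (c : Fin m → Poly (d * n)) →
  (∀ e → e ∉ T → c e ≈ₚ 0ₚ) →
  (∀ i v → ∑ (λ e → c e *ₚ rigidityMatrix d G e i v) ≈ₚ 0ₚ) →
  ∀ e → c e ≈ₚ 0ₚ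

-- The rigidity matrix of G, with rows indexed by `edges G`, has rank r.
HasRank : (d : ℕ) → Graph n m → ℕ → Set
HasRank {m = m} d G r =
  (Σ[ T ∈ Subset m ] T ⊆ edges G × IndependentRows d G T × ∣ T ∣ ≡ r) ×
  (∀ T → T ⊆ edges G → IndependentRows d G T → ∣ T ∣ ≤ r)

-- A generic framework is rigid iff it is infinitesimally rigid, that is, iff
-- its only infinitesimal motions are the trivial ones, which form a space of
-- dimension (d+1 choose 2) when n ≥ d.  Meaningful for n ≥ d only.
Rigid : (d : ℕ) → Graph n m → Set
Rigid {n} d G = HasRank d G (d * n ∸ (suc d C 2))

MinimallyRigid : (d : ℕ) → Graph n m → Set
MinimallyRigid {n} d G =
  Rigid d G ×
  (∀ {m′} (H : Graph n m′) → Rigid d H → ∣ edges G ∣ ≤ ∣ edges H ∣)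

-- Over the domain of polynomials in the generic coordinates, apply a shear making e parallel to the
-- first axis: X₁ = x₁, while X₂ and X₃ agree on the ends of e and so place the vertices of G/e in
-- general position in the plane.  Write Yᵢ(f) for the difference of Xᵢ along the edge f.  Let L be
-- the space of stresses of G/e in directions 2 and 3, and K the space of stresses of G in
-- directions 1 and 2.  The rows outside a set S are independent exactly when a stress vanishing on
-- S is zero, so it suffices to partition E - e into classes on which the stresses in L, in L again
-- and in K are determined by their values.  Such a partition exists, as in the Laplace expansion of
-- a nonzero determinant, if the spaces Y₂L, Y₁L and Y₂K are independent.
--
-- Let Y₂a + Y₁b + Y₂c = 0 with a, b in L and c in K.  Then Y₁b is in equilibrium on G/e, that is, b
-- is a stress in direction 1 as well, so it extends over e to a stress of G and vanishes.  Hence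
-- c = -a off e, and c is a stress also in direction 3; so c, and with it a, vanishes.
--
-- The sizes of the classes are forced, since in the plane at most 2|V| - 3 rows are independent.
module Submission where

open import Defs
open import Algebra.Bundles using (CommutativeMonoid; CommutativeRing)
open import Algebra.Morphism.Structures using (module RingMorphisms)
import Algebra.Properties.CommutativeMonoid.Sum as MonoidSum
import Algebra.Properties.CommutativeSemigroup as CommutativeSemigroupProperties
import Algebra.Properties.Ring as RingProperties
import Algebra.Properties.Semiring.Exp as Exp
import Algebra.Properties.Semiring.Sum as SemiringSum
import Algebra.Solver.Ring.NaturalCoefficients.Default as SemiringSolver
open import Data.Bool using (true; false; if_then_else_)
open import Data.Fin using (Fin; zero; suc; combine; remQuot; punchIn)
import Data.Fin as Fin
open import Data.Fin.Patterns using (0F; 1F; 2F)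
import Data.Fin.Properties as Finₚ
open import Data.Fin.Subset using (Subset; _∈_; _∉_; _⊆_; _∪_; _∩_; ∣_∣; Empty; inside; outside) renaming (_-_ to _∖_)
open import Data.Fin.Subset.Properties using
  ( _∈?_; drop-∷-Empty; p─⊥≡p; p─q⊆p; p⊂q⇒∣p∣<∣q∣; p⊆q⇒∣p∣≤∣q∣; x∈p∧x≢y⇒x∈p-y; x∈p∩q⁺; x∈p∩q⁻; x∈p∪q⁺; x∈p∪q⁻
  ; ⊆-antisym; ⊆-refl; ⊆-trans )
open import Data.List using (List; []; _∷_; _++_; map; length; tabulate; concat)
open import Data.List.Membership.Propositional using () renaming (_∈_ to _∈ˡ_)
open import Data.List.Membership.Propositional.Properties using (∈-map⁺)
import Data.List.Properties as Listₚ
open import Data.List.Relation.Unary.All using (All; []; _∷_)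
import Data.List.Relation.Unary.All as All
import Data.List.Relation.Unary.All.Properties as Allₚ
open import Data.List.Relation.Unary.Any using (here; there)
open import Data.Nat using (ℕ; zero; suc; _≤_; _<_; _>_; _∸_; z≤n; s≤s)
import Data.Nat as ℕ
open import Data.Nat.Combinatorics using (_C_)
import Data.Nat.Properties as ℕₚ
open import Data.Nat.Tactic.RingSolver using (solve-∀)
open import Data.Product using (Σ-syntax; ∃; _×_; _,_; proj₁; proj₂; uncurry)
open import Data.Rational using (ℚ; 0ℚ; 1ℚ)
import Data.Rational as ℚ
import Data.Rational.Properties as ℚₚ
open import Data.Sum using (_⊎_; inj₁; inj₂; [_,_]′)
open import Data.Vec using ([]; _∷_; here; there; lookup; replicate; zipWith; _[_]≔_)
import Data.Vec as Vec
import Data.Vec.Functional as Vector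
import Data.Vec.Properties as Vecₚ
open import Function using (_∘_; id)
open import Level using (0ℓ)
open import Relation.Binary using (tri<; tri≈; tri>)
open import Relation.Binary.PropositionalEquality as ≡ using (_≡_; _≢_)
import Relation.Binary.Reasoning.Setoid as ≈-Reasoning
open import Relation.Nullary using (Dec; does; yes; no; ¬_; ¬?; contradiction)
open import Relation.Nullary.Decidable using (decidable-stable; dec-true; dec-false)

-- The spaces fit because of their dimensions. `E - e` has 3|V| - 7 edges; plane ranks of at most
-- 2(|V| - 1) - 3 on G/e and 2|V| - 3 on G give L dimension at least |V| - 2 and K at least |V| - 3,
-- so two copies of L and one of K leave no room. Each class is the complement of a set that has to
-- be independent: the first copy of L serves S₂ ∪ S₃ and the second S₁ ∪ S₃, both in G/e, and K
-- serves S₁ ∪ S₂ in G. As Y₂ vanishes at e, the coordinate at e never helps to determine a stress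
-- in K; so e lies outside the count and can be put into S₁ afterwards.
--
-- The obstacle is that three generic placements occur, each over its own polynomial ring: G in
-- space, G in the plane and G/e in the plane. A dependency in the plane is moved to the spatial
-- ring by a substitution with a left inverse, hence without loss. For G/e the left inverse is a
-- degenerate placement of G in space, which shows that the sheared coordinates are as good as
-- generic ones.
--
-- No fractions are formed: all elimination is done over an integral domain with decidable equality
-- to zero.

private
  variable
    d k l m n r : ℕ

-- Polynomials over ℚ as functionals on families of values.

module Polynomials where
  open ≡ using (refl; sym; trans; cong; cong₂; module ≡-Reasoning)

  private
    module ℚ+ = CommutativeSemigroupProperties (CommutativeMonoid.commutativeSemigroup ℚₚ.+-0-commutativeMonoid)
    module ℚ* = CommutativeSemigroupProperties (CommutativeMonoid.commutativeSemigroup ℚₚ.*-1-commutativeMonoid)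

  ℚ-noZeroDivisors : ∀ a b → a ≢ 0ℚ → a ℚ.* b ≡ 0ℚ → b ≡ 0ℚ
  ℚ-noZeroDivisors a b a≢0 ab≡0 = begin
    b                     ≡⟨ ℚₚ.*-identityˡ b ⟨
    1ℚ ℚ.* b              ≡⟨ cong (ℚ._* b) (ℚₚ.*-inverseˡ a) ⟨
    (ℚ.1/ a) ℚ.* a ℚ.* b  ≡⟨ ℚₚ.*-assoc (ℚ.1/ a) a b ⟩
    (ℚ.1/ a) ℚ.* (a ℚ.* b) ≡⟨ cong ((ℚ.1/ a) ℚ.*_) ab≡0 ⟩
    (ℚ.1/ a) ℚ.* 0ℚ       ≡⟨ ℚₚ.*-zeroʳ (ℚ.1/ a) ⟩
    0ℚ                    ∎
    where
    open ≡-Reasoning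
    instance _ = ℚ.≢-nonZero a≢0

  infixl 6 _⊕_
  _⊕_ : Monomial k → Monomial k → Monomial k
  _⊕_ = zipWith ℕ._+_

  ⊕-assoc : (α β γ : Monomial k) → α ⊕ β ⊕ γ ≡ α ⊕ (β ⊕ γ)
  ⊕-assoc = Vecₚ.zipWith-assoc ℕₚ.+-assoc

  ⊕-comm : (α β : Monomial k) → α ⊕ β ≡ β ⊕ α
  ⊕-comm = Vecₚ.zipWith-comm ℕₚ.+-comm

  ⊕-identityˡ : (α : Monomial k) → replicate k 0 ⊕ α ≡ α
  ⊕-identityˡ = Vecₚ.zipWith-identityˡ ℕₚ.+-identityˡ

  -- The value of a polynomial under the linear map sending each monomial α to h α.
  -- Equality of polynomials is equality of all these values (⟪⟫-congˡ and
  -- ⟪⟫-ext), and for them the ring laws are Fubini's theorem for finite sums.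
  ⟪_,_⟫ : Poly k → (Monomial k → ℚ) → ℚ
  ⟪ []          , h ⟫ = 0ℚ
  ⟪ (a , α) ∷ p , h ⟫ = a ℚ.* h α ℚ.+ ⟪ p , h ⟫

  ⟪⟫-congʳ : ∀ (p : Poly k) {h h′} → (∀ α → h α ≡ h′ α) → ⟪ p , h ⟫ ≡ ⟪ p , h′ ⟫
  ⟪⟫-congʳ []            h≡ = refl
  ⟪⟫-congʳ ((a , α) ∷ p) h≡ = cong₂ (λ x y → a ℚ.* x ℚ.+ y) (h≡ α) (⟪⟫-congʳ p h≡)

  ⟪⟫-++ : ∀ (p q : Poly k) h → ⟪ p ++ q , h ⟫ ≡ ⟪ p , h ⟫ ℚ.+ ⟪ q , h ⟫
  ⟪⟫-++ []            q h = sym (ℚₚ.+-identityˡ _)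
  ⟪⟫-++ ((a , α) ∷ p) q h =
    trans (cong (a ℚ.* h α ℚ.+_) (⟪⟫-++ p q h)) (sym (ℚₚ.+-assoc (a ℚ.* h α) _ _))

  ⟪⟫-+ : ∀ (p : Poly k) g h → ⟪ p , (λ α → g α ℚ.+ h α) ⟫ ≡ ⟪ p , g ⟫ ℚ.+ ⟪ p , h ⟫
  ⟪⟫-+ []            g h = sym (ℚₚ.+-identityˡ _)
  ⟪⟫-+ ((a , α) ∷ p) g h =
    trans (cong₂ ℚ._+_ (ℚₚ.*-distribˡ-+ a (g α) (h α)) (⟪⟫-+ p g h)) (ℚ+.interchange (a ℚ.* g α) (a ℚ.* h α) ⟪ p , g ⟫ ⟪ p , h ⟫)

  ⟪⟫-* : ∀ (p : Poly k) b h → ⟪ p , (λ α → b ℚ.* h α) ⟫ ≡ b ℚ.* ⟪ p , h ⟫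
  ⟪⟫-* []            b h = sym (ℚₚ.*-zeroʳ b)
  ⟪⟫-* ((a , α) ∷ p) b h =
    trans (cong₂ ℚ._+_ (ℚ*.x∙yz≈y∙xz a b (h α)) (⟪⟫-* p b h)) (sym (ℚₚ.*-distribˡ-+ b _ _))

  ⟪⟫-vanish : ∀ (p : Poly k) {h} → All (λ (_ , α) → h α ≡ 0ℚ) p → ⟪ p , h ⟫ ≡ 0ℚ
  ⟪⟫-vanish []            []         = refl
  ⟪⟫-vanish ((a , α) ∷ p) (hα ∷ hp) =
    trans (cong₂ (λ x y → a ℚ.* x ℚ.+ y) hα (⟪⟫-vanish p hp)) (trans (ℚₚ.+-identityʳ _) (ℚₚ.*-zeroʳ a))

  ⟪⟫-neg : ∀ (p : Poly k) h → ⟪ -ₚ p , h ⟫ ≡ ℚ.- ⟪ p , h ⟫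
  ⟪⟫-neg []            h = refl
  ⟪⟫-neg ((a , α) ∷ p) h =
    trans (cong₂ ℚ._+_ (sym (ℚₚ.neg-distribˡ-* a (h α))) (⟪⟫-neg p h)) (sym (ℚₚ.neg-distrib-+ (a ℚ.* h α) _))

  ⟪⟫-swap : ∀ (p : Poly k) (q : Poly l) (h : Monomial k → Monomial l → ℚ) →
    ⟪ p , (λ α → ⟪ q , h α ⟫) ⟫ ≡ ⟪ q , (λ β → ⟪ p , (λ α → h α β) ⟫) ⟫
  ⟪⟫-swap []            q h = sym (⟪⟫-vanish q (All.tabulate λ _ → refl))
  ⟪⟫-swap ((a , α) ∷ p) q h =
    trans (cong₂ ℚ._+_ (sym (⟪⟫-* q a (h α))) (⟪⟫-swap p q h)) (sym (⟪⟫-+ q _ _))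

  ⟪⟫-*ₚ : ∀ (p q : Poly k) h → ⟪ p *ₚ q , h ⟫ ≡ ⟪ p , (λ α → ⟪ q , (λ β → h (α ⊕ β)) ⟫) ⟫
  ⟪⟫-*ₚ []            q h = refl
  ⟪⟫-*ₚ ((a , α) ∷ p) q h =
    trans (⟪⟫-++ (map _ q) (p *ₚ q) h) (cong₂ ℚ._+_ (scale q) (⟪⟫-*ₚ p q h))
    where
    scale : ∀ q → ⟪ map (λ (b , β) → a ℚ.* b , α ⊕ β) q , h ⟫ ≡ a ℚ.* ⟪ q , (λ β → h (α ⊕ β)) ⟫
    scale []            = sym (ℚₚ.*-zeroʳ a)
    scale ((b , β) ∷ q) =
      trans (cong₂ ℚ._+_ (ℚₚ.*-assoc a b _) (scale q)) (sym (ℚₚ.*-distribˡ-+ a _ _))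

  χ : Monomial k → Monomial k → ℚ
  χ α β = if does (Vecₚ.≡-dec ℕ._≟_ β α) then 1ℚ else 0ℚ

  χ-≡ : (α : Monomial k) → χ α α ≡ 1ℚ
  χ-≡ α rewrite dec-true (Vecₚ.≡-dec ℕ._≟_ α α) refl = refl

  χ-≢ : {α β : Monomial k} → β ≢ α → χ α β ≡ 0ℚ
  χ-≢ {α = α} {β} β≢α rewrite dec-false (Vecₚ.≡-dec ℕ._≟_ β α) β≢α = refl

  coeff-⟪⟫ : ∀ (p : Poly k) α → coeff p α ≡ ⟪ p , χ α ⟫
  coeff-⟪⟫ []            α = refl
  coeff-⟪⟫ ((a , β) ∷ p) α = cong₂ ℚ._+_ (head (does (Vecₚ.≡-dec ℕ._≟_ β α))) (coeff-⟪⟫ p α)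
    where
    head : ∀ b → (if b then a else 0ℚ) ≡ a ℚ.* (if b then 1ℚ else 0ℚ)
    head true  = sym (ℚₚ.*-identityʳ a)
    head false = sym (ℚₚ.*-zeroʳ a)

  ⟪⟫-ext : {p q : Poly k} → (∀ h → ⟪ p , h ⟫ ≡ ⟪ q , h ⟫) → p ≈ₚ q
  ⟪⟫-ext {p = p} {q} eq α = trans (coeff-⟪⟫ p α) (trans (eq (χ α)) (sym (coeff-⟪⟫ q α)))

  -- Monomial order, normal forms and the meaning of equality.

  infix 4 _≺_
  -- The lexicographic order. It is total and strictly compatible with `⊕`, so the least monomials
  -- of two polynomials multiply to a monomial of the product that nothing else can cancel.
  data _≺_ : Monomial k → Monomial k → Set where
    here  : ∀ {i j} {α β : Monomial k} → i < j → i ∷ α ≺ j ∷ β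
    there : ∀ {i} {α β : Monomial k} → α ≺ β → i ∷ α ≺ i ∷ β

  ≺-irrefl : {α : Monomial k} → ¬ α ≺ α
  ≺-irrefl (here i<i)  = ℕₚ.<-irrefl refl i<i
  ≺-irrefl (there α≺α) = ≺-irrefl α≺α

  ≺-trans : {α β γ : Monomial k} → α ≺ β → β ≺ γ → α ≺ γ
  ≺-trans (here p)  (here q)  = here (ℕₚ.<-trans p q)
  ≺-trans (here p)  (there _) = here p
  ≺-trans (there _) (here q)  = here q
  ≺-trans (there p) (there q) = there (≺-trans p q)

  data Comparison (α β : Monomial k) : Set where
    less    : α ≺ β → Comparison α β
    equal   : α ≡ β → Comparison α β
    greater : β ≺ α → Comparison α β

  compare : (α β : Monomial k) → Comparison α β
  compare []      []      = equal refl
  compare (i ∷ α) (j ∷ β) with ℕₚ.<-cmp i j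
  ... | tri< i<j _ _ = less (here i<j)
  ... | tri> _ _ j<i = greater (here j<i)
  ... | tri≈ _ refl _ with compare α β
  ...   | less α≺β    = less (there α≺β)
  ...   | equal refl  = equal refl
  ...   | greater β≺α = greater (there β≺α)

  ⊕-monoʳ : (α : Monomial k) {β γ : Monomial k} → β ≺ γ → α ⊕ β ≺ α ⊕ γ
  ⊕-monoʳ (i ∷ α) (here p)  = here (ℕₚ.+-monoʳ-< i p)
  ⊕-monoʳ (i ∷ α) (there p) = there (⊕-monoʳ α p)

  ⊕-monoˡ : {α β : Monomial k} (γ : Monomial k) → α ≺ β → α ⊕ γ ≺ β ⊕ γ
  ⊕-monoˡ {α = α} {β} γ p = subst₂≺ (⊕-comm γ α) (⊕-comm γ β) (⊕-monoʳ γ p)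
    where
    subst₂≺ : ∀ {α α′ β β′ : Monomial k} → α ≡ α′ → β ≡ β′ → α ≺ β → α′ ≺ β′
    subst₂≺ refl refl p = p

  Above : Monomial k → Poly k → Set
  Above α = All (λ (_ , β) → α ≺ β)

  data Normal {k} : Poly k → Set where
    []  : Normal []
    _∷_ : ∀ {a α p} → a ≢ 0ℚ × Above α p → Normal p → Normal ((a , α) ∷ p)

  NormalForm : Poly k → Set
  NormalForm {k} p = Σ[ q ∈ Poly k ] Normal q × (∀ h → ⟪ q , h ⟫ ≡ ⟪ p , h ⟫)

  -- The last component is the invariant of the recursion: it allows a smaller head to be put back
  -- in front of the result.
  insert : ∀ a (α : Monomial k) p → a ≢ 0ℚ → Normal p →
    Σ[ q ∈ Poly k ] Normal q × (∀ h → ⟪ q , h ⟫ ≡ ⟪ (a , α) ∷ p , h ⟫) ×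
      (∀ {γ} → γ ≺ α → Above γ p → Above γ q)
  insert a α [] a≢0 [] = (a , α) ∷ [] , (a≢0 , []) ∷ [] , (λ h → refl) , λ γ≺α _ → γ≺α ∷ []
  insert a α ((b , β) ∷ p) a≢0 ((b≢0 , β≺p) ∷ np) with compare α β
  ... | less α≺β =
    (a , α) ∷ (b , β) ∷ p , (a≢0 , α≺β ∷ All.map (≺-trans α≺β) β≺p) ∷ (b≢0 , β≺p) ∷ np ,
    (λ h → refl) , λ γ≺α γ≺p → γ≺α ∷ γ≺p
  ... | greater β≺α with insert a α p a≢0 np
  ...   | q , nq , eq , above =
    (b , β) ∷ q , (b≢0 , above β≺α β≺p) ∷ nq ,
    (λ h → trans (cong (b ℚ.* h β ℚ.+_) (eq h)) (ℚ+.x∙yz≈y∙xz (b ℚ.* h β) (a ℚ.* h α) ⟪ p , h ⟫)) ,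
    λ { γ≺α (γ≺β ∷ γ≺p) → γ≺β ∷ above γ≺α γ≺p }
  insert a α ((b , β) ∷ p) a≢0 ((b≢0 , β≺p) ∷ np) | equal refl with a ℚ.+ b ℚ.≟ 0ℚ
  ... | yes a+b≡0 = p , np , value , λ { _ (_ ∷ γ≺p) → γ≺p }
    where
    open ≡-Reasoning
    value : ∀ h → ⟪ p , h ⟫ ≡ a ℚ.* h α ℚ.+ (b ℚ.* h α ℚ.+ ⟪ p , h ⟫)
    value h = begin
      ⟪ p , h ⟫                                     ≡⟨ ℚₚ.+-identityˡ _ ⟨
      0ℚ ℚ.+ ⟪ p , h ⟫                              ≡⟨ cong (ℚ._+ ⟪ p , h ⟫) (ℚₚ.*-zeroˡ (h α)) ⟨
      0ℚ ℚ.* h α ℚ.+ ⟪ p , h ⟫                      ≡⟨ cong (λ x → x ℚ.* h α ℚ.+ ⟪ p , h ⟫) a+b≡0 ⟨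
      (a ℚ.+ b) ℚ.* h α ℚ.+ ⟪ p , h ⟫               ≡⟨ cong (ℚ._+ ⟪ p , h ⟫) (ℚₚ.*-distribʳ-+ (h α) a b) ⟩
      a ℚ.* h α ℚ.+ b ℚ.* h α ℚ.+ ⟪ p , h ⟫         ≡⟨ ℚₚ.+-assoc (a ℚ.* h α) _ _ ⟩
      a ℚ.* h α ℚ.+ (b ℚ.* h α ℚ.+ ⟪ p , h ⟫)       ∎
  ... | no a+b≢0 =
    (a ℚ.+ b , α) ∷ p , (a+b≢0 , β≺p) ∷ np ,
    (λ h → trans (cong (ℚ._+ ⟪ p , h ⟫) (ℚₚ.*-distribʳ-+ (h α) a b)) (ℚₚ.+-assoc (a ℚ.* h α) _ _)) ,
    λ { γ≺α (_ ∷ γ≺p) → γ≺α ∷ γ≺p }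

  normalise : (p : Poly k) → NormalForm p
  normalise []            = [] , [] , λ h → refl
  normalise ((a , α) ∷ p) with normalise p | a ℚ.≟ 0ℚ
  ... | q , nq , eq | yes refl =
    q , nq , λ h → trans (eq h) (sym
      (trans (cong (ℚ._+ ⟪ p , h ⟫) (ℚₚ.*-zeroˡ (h α))) (ℚₚ.+-identityˡ _)))
  ... | q , nq , eq | no a≢0 with insert a α q a≢0 nq
  ...   | r , nr , eq′ , _ = r , nr , λ h → trans (eq′ h) (cong (a ℚ.* h α ℚ.+_) (eq h))

  ≺⇒≢ : {α β : Monomial k} → α ≺ β → β ≢ α
  ≺⇒≢ α≺α refl = ≺-irrefl α≺α

  leading : ∀ {a} {α : Monomial k} {p} → Above α p → ⟪ (a , α) ∷ p , χ α ⟫ ≡ a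
  leading {a = a} {α} {p} α≺p = begin
    a ℚ.* χ α α ℚ.+ ⟪ p , χ α ⟫ ≡⟨ cong₂ (λ x y → a ℚ.* x ℚ.+ y) (χ-≡ α) (⟪⟫-vanish p (All.map (χ-≢ ∘ ≺⇒≢) α≺p)) ⟩
    a ℚ.* 1ℚ ℚ.+ 0ℚ             ≡⟨ ℚₚ.+-identityʳ _ ⟩
    a ℚ.* 1ℚ                    ≡⟨ ℚₚ.*-identityʳ a ⟩
    a                           ∎
    where open ≡-Reasoning

  -- The hypothesis speaks only of the functions `χ α`. It extends to every `h` because the least
  -- term of a nonempty normal form would be a nonzero coefficient of `p`.
  ⟪⟫-zero : ∀ {p : Poly k} → p ≈ₚ 0ₚ → ∀ h → ⟪ p , h ⟫ ≡ 0ℚ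
  ⟪⟫-zero {p = p} p≈0 h with normalise p
  ... | [] , _ , eq = sym (eq h)
  ... | (a , α) ∷ q , (a≢0 , α≺q) ∷ _ , eq =
    contradiction (trans (sym (leading α≺q)) (trans (eq (χ α)) (trans (sym (coeff-⟪⟫ p α)) (p≈0 α)))) a≢0

  x-y≡0⇒x≡y : ∀ x y → x ℚ.- y ≡ 0ℚ → x ≡ y
  x-y≡0⇒x≡y x y eq = begin
    x                     ≡⟨ ℚₚ.+-identityʳ x ⟨
    x ℚ.+ 0ℚ              ≡⟨ cong (x ℚ.+_) (ℚₚ.+-inverseˡ y) ⟨
    x ℚ.+ (ℚ.- y ℚ.+ y)   ≡⟨ ℚₚ.+-assoc x (ℚ.- y) y ⟨
    x ℚ.- y ℚ.+ y         ≡⟨ cong (ℚ._+ y) eq ⟩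
    0ℚ ℚ.+ y              ≡⟨ ℚₚ.+-identityˡ y ⟩
    y                     ∎
    where open ≡-Reasoning

  ⟪⟫-congˡ : ∀ {p q : Poly k} → p ≈ₚ q → ∀ h → ⟪ p , h ⟫ ≡ ⟪ q , h ⟫
  ⟪⟫-congˡ {p = p} {q} p≈q h =
    x-y≡0⇒x≡y _ _ (trans (sym (value h)) (⟪⟫-zero {p = p -ₚ q} p-q≈0 h))
    where
    value : ∀ h → ⟪ p -ₚ q , h ⟫ ≡ ⟪ p , h ⟫ ℚ.- ⟪ q , h ⟫
    value h = trans (⟪⟫-++ p (-ₚ q) h) (cong (⟪ p , h ⟫ ℚ.+_) (⟪⟫-neg q h))
    p-q≈0 : p -ₚ q ≈ₚ 0ₚ
    p-q≈0 α = begin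
      coeff (p -ₚ q) α              ≡⟨ coeff-⟪⟫ (p -ₚ q) α ⟩
      ⟪ p -ₚ q , χ α ⟫              ≡⟨ value (χ α) ⟩
      ⟪ p , χ α ⟫ ℚ.- ⟪ q , χ α ⟫   ≡⟨ cong₂ ℚ._-_ (coeff-⟪⟫ p α) (coeff-⟪⟫ q α) ⟨
      coeff p α ℚ.- coeff q α       ≡⟨ cong (ℚ._- coeff q α) (p≈q α) ⟩
      coeff q α ℚ.- coeff q α       ≡⟨ ℚₚ.+-inverseʳ (coeff q α) ⟩
      0ℚ                            ∎
      where open ≡-Reasoning

  -- The polynomial ring is an integral domain with a zero test.

  1ₚ : Poly k
  1ₚ = (1ℚ , replicate _ 0) ∷ []

  ⟪⟫-term : ∀ (α : Monomial k) h → ⟪ (1ℚ , α) ∷ [] , h ⟫ ≡ h α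
  ⟪⟫-term α h = trans (ℚₚ.+-identityʳ _) (ℚₚ.*-identityˡ (h α))

  *ₚ-cong : ∀ {p p′ q q′ : Poly k} → p ≈ₚ p′ → q ≈ₚ q′ → p *ₚ q ≈ₚ p′ *ₚ q′
  *ₚ-cong {p = p} {p′} {q} {q′} p≈ q≈ = ⟪⟫-ext {p = p *ₚ q} {p′ *ₚ q′} λ h → begin
    ⟪ p *ₚ q , h ⟫                              ≡⟨ ⟪⟫-*ₚ p q h ⟩
    ⟪ p , (λ α → ⟪ q , (λ β → h (α ⊕ β)) ⟫) ⟫   ≡⟨ ⟪⟫-congʳ p (λ α → ⟪⟫-congˡ {p = q} {q′} q≈ _) ⟩
    ⟪ p , (λ α → ⟪ q′ , (λ β → h (α ⊕ β)) ⟫) ⟫  ≡⟨ ⟪⟫-congˡ {p = p} {p′} p≈ _ ⟩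
    ⟪ p′ , (λ α → ⟪ q′ , (λ β → h (α ⊕ β)) ⟫) ⟫ ≡⟨ ⟪⟫-*ₚ p′ q′ h ⟨
    ⟪ p′ *ₚ q′ , h ⟫                            ∎
    where open ≡-Reasoning

  *ₚ-comm : ∀ (p q : Poly k) → p *ₚ q ≈ₚ q *ₚ p
  *ₚ-comm p q = ⟪⟫-ext {p = p *ₚ q} {q *ₚ p} λ h → begin
    ⟪ p *ₚ q , h ⟫                              ≡⟨ ⟪⟫-*ₚ p q h ⟩
    ⟪ p , (λ α → ⟪ q , (λ β → h (α ⊕ β)) ⟫) ⟫   ≡⟨ ⟪⟫-swap p q _ ⟩
    ⟪ q , (λ β → ⟪ p , (λ α → h (α ⊕ β)) ⟫) ⟫   ≡⟨ ⟪⟫-congʳ q (λ β → ⟪⟫-congʳ p λ α → cong h (⊕-comm α β)) ⟩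
    ⟪ q , (λ β → ⟪ p , (λ α → h (β ⊕ α)) ⟫) ⟫   ≡⟨ ⟪⟫-*ₚ q p h ⟨
    ⟪ q *ₚ p , h ⟫                              ∎
    where open ≡-Reasoning

  *ₚ-assoc : ∀ (p q r : Poly k) → p *ₚ q *ₚ r ≈ₚ p *ₚ (q *ₚ r)
  *ₚ-assoc p q r = ⟪⟫-ext {p = p *ₚ q *ₚ r} {p *ₚ (q *ₚ r)} λ h → begin
    ⟪ p *ₚ q *ₚ r , h ⟫
      ≡⟨ trans (⟪⟫-*ₚ (p *ₚ q) r h) (⟪⟫-*ₚ p q _) ⟩
    ⟪ p , (λ α → ⟪ q , (λ β → ⟪ r , (λ γ → h (α ⊕ β ⊕ γ)) ⟫) ⟫) ⟫
      ≡⟨ ⟪⟫-congʳ p (λ α → ⟪⟫-congʳ q λ β → ⟪⟫-congʳ r λ γ → cong h (⊕-assoc α β γ)) ⟩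
    ⟪ p , (λ α → ⟪ q , (λ β → ⟪ r , (λ γ → h (α ⊕ (β ⊕ γ))) ⟫) ⟫) ⟫
      ≡⟨ trans (⟪⟫-*ₚ p (q *ₚ r) h) (⟪⟫-congʳ p λ α → ⟪⟫-*ₚ q r _) ⟨
    ⟪ p *ₚ (q *ₚ r) , h ⟫
      ∎
    where open ≡-Reasoning

  *ₚ-identityˡ : ∀ (p : Poly k) → 1ₚ *ₚ p ≈ₚ p
  *ₚ-identityˡ p = ⟪⟫-ext {p = 1ₚ *ₚ p} {p} λ h →
    trans (⟪⟫-*ₚ 1ₚ p h) (trans (⟪⟫-term (replicate _ 0) (λ α → ⟪ p , (λ β → h (α ⊕ β)) ⟫))
      (⟪⟫-congʳ p λ α → cong h (⊕-identityˡ α)))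

  *ₚ-distribʳ : ∀ (r p q : Poly k) → (p +ₚ q) *ₚ r ≈ₚ p *ₚ r +ₚ q *ₚ r
  *ₚ-distribʳ r p q = ⟪⟫-ext {p = (p +ₚ q) *ₚ r} {p *ₚ r +ₚ q *ₚ r} λ h → begin
    ⟪ (p +ₚ q) *ₚ r , h ⟫               ≡⟨ ⟪⟫-*ₚ (p +ₚ q) r h ⟩
    ⟪ p +ₚ q , _ ⟫                      ≡⟨ ⟪⟫-++ p q _ ⟩
    ⟪ p , _ ⟫ ℚ.+ ⟪ q , _ ⟫             ≡⟨ cong₂ ℚ._+_ (⟪⟫-*ₚ p r h) (⟪⟫-*ₚ q r h) ⟨
    ⟪ p *ₚ r , h ⟫ ℚ.+ ⟪ q *ₚ r , h ⟫   ≡⟨ ⟪⟫-++ (p *ₚ r) (q *ₚ r) h ⟨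
    ⟪ p *ₚ r +ₚ q *ₚ r , h ⟫            ∎
    where open ≡-Reasoning

  coeff-++ : ∀ (p q : Poly k) α → coeff (p +ₚ q) α ≡ coeff p α ℚ.+ coeff q α
  coeff-++ p q α = begin
    coeff (p +ₚ q) α              ≡⟨ coeff-⟪⟫ (p +ₚ q) α ⟩
    ⟪ p +ₚ q , χ α ⟫              ≡⟨ ⟪⟫-++ p q (χ α) ⟩
    ⟪ p , χ α ⟫ ℚ.+ ⟪ q , χ α ⟫   ≡⟨ cong₂ ℚ._+_ (coeff-⟪⟫ p α) (coeff-⟪⟫ q α) ⟨
    coeff p α ℚ.+ coeff q α       ∎
    where open ≡-Reasoning

  coeff-neg : ∀ (p : Poly k) α → coeff (-ₚ p) α ≡ ℚ.- coeff p α
  coeff-neg p α = trans (coeff-⟪⟫ (-ₚ p) α) (trans (⟪⟫-neg p (χ α)) (cong ℚ.-_ (sym (coeff-⟪⟫ p α))))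

  polyRing : ℕ → CommutativeRing 0ℓ 0ℓ
  polyRing k = record
    { Carrier = Poly k ; _≈_ = _≈ₚ_ ; _+_ = _+ₚ_ ; _*_ = _*ₚ_ ; -_ = -ₚ_ ; 0# = 0ₚ ; 1# = 1ₚ
    ; isCommutativeRing = record
      { isRing = record
        { +-isAbelianGroup = record
          { isGroup = record
            { isMonoid = record
              { isSemigroup = record
                { isMagma = record
                  { isEquivalence = record
                    { refl  = λ α → refl
                    ; sym   = λ p≈q α → sym (p≈q α)
                    ; trans = λ p≈q q≈r α → trans (p≈q α) (q≈r α)
                    }
                  ; ∙-cong = λ {p} {p′} {q} {q′} p≈ q≈ α →
                      trans (coeff-++ p q α) (trans (cong₂ ℚ._+_ (p≈ α) (q≈ α)) (sym (coeff-++ p′ q′ α)))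
                  }
                ; assoc = λ p q r α → cong (λ s → coeff s α) (++-assoc p q r)
                }
              ; identity = (λ p α → refl) , λ p α → cong (λ s → coeff s α) (++-identityʳ p)
              }
            ; inverse =
                (λ p α → trans (coeff-++ (-ₚ p) p α) (trans (cong (ℚ._+ coeff p α) (coeff-neg p α)) (ℚₚ.+-inverseˡ (coeff p α)))) ,
                (λ p α → trans (coeff-++ p (-ₚ p) α) (trans (cong (coeff p α ℚ.+_) (coeff-neg p α)) (ℚₚ.+-inverseʳ (coeff p α))))
            ; ⁻¹-cong = λ {p} {q} p≈q α → trans (coeff-neg p α) (trans (cong ℚ.-_ (p≈q α)) (sym (coeff-neg q α)))
            }
          ; comm = +ₚ-comm
          }
        ; *-cong = λ {p} {p′} {q} {q′} → *ₚ-cong {p = p} {p′} {q} {q′}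
        ; *-assoc = *ₚ-assoc
        ; *-identity = *ₚ-identityˡ , λ p α → trans (*ₚ-comm p 1ₚ α) (*ₚ-identityˡ p α)
        ; distrib =
            (λ r p q α → trans (*ₚ-comm r (p +ₚ q) α) (trans (*ₚ-distribʳ r p q α)
              (trans (coeff-++ (p *ₚ r) (q *ₚ r) α) (trans (cong₂ ℚ._+_ (*ₚ-comm p r α) (*ₚ-comm q r α))
                (sym (coeff-++ (r *ₚ p) (r *ₚ q) α)))))) ,
            *ₚ-distribʳ
        }
      ; *-comm = *ₚ-comm
      }
    }
    where
    open import Data.List.Properties using (++-assoc; ++-identityʳ)
    +ₚ-comm : (p q : Poly k) → p +ₚ q ≈ₚ q +ₚ p
    +ₚ-comm p q α = trans (coeff-++ p q α) (trans (ℚₚ.+-comm (coeff p α) (coeff q α)) (sym (coeff-++ q p α)))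

  1ₚ≉0ₚ : ¬ (1ₚ {k} ≈ₚ 0ₚ)
  1ₚ≉0ₚ {k} 1≈0 with () ← trans (sym (leading {a = 1ℚ} {α = replicate k 0} [])) (⟪⟫-zero {p = 1ₚ} 1≈0 (χ (replicate k 0)))

  _≟0ₚ : (p : Poly k) → Dec (p ≈ₚ 0ₚ)
  p ≟0ₚ with normalise p
  ... | [] , _ , eq = yes (⟪⟫-ext {p = p} {0ₚ} λ h → sym (eq h))
  ... | (a , α) ∷ q , (a≢0 , α≺q) ∷ _ , eq =
    no λ p≈0 → a≢0 (trans (sym (leading α≺q)) (trans (eq (χ α)) (⟪⟫-zero {p = p} p≈0 (χ α))))

  *ₚ-noZeroDivisors : (p q : Poly k) → p *ₚ q ≈ₚ 0ₚ → p ≈ₚ 0ₚ ⊎ q ≈ₚ 0ₚ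
  *ₚ-noZeroDivisors p q pq≈0 with normalise p | normalise q
  ... | [] , _ , eq | _ = inj₁ (⟪⟫-ext {p = p} {0ₚ} λ h → sym (eq h))
  ... | _ ∷ _ , _ | [] , _ , eq = inj₂ (⟪⟫-ext {p = q} {0ₚ} λ h → sym (eq h))
  ... | (a , α) ∷ p′ , (a≢0 , α≺p′) ∷ _ , p≡ | (b , β) ∷ q′ , (b≢0 , β≺q′) ∷ _ , q≡ =
    contradiction (ℚ-noZeroDivisors a b a≢0 ab≡0) b≢0
    where
    open ≡-Reasoning
    -- Pairing `p` with `row` gives the coefficient of `α ⊕ β` in the product. A monomial of `p`
    -- above `α` yields only monomials above `α ⊕ β`, so just the product of the two least terms
    -- remains.
    row : Monomial _ → ℚ
    row γ = ⟪ (b , β) ∷ q′ , (λ ε → χ (α ⊕ β) (γ ⊕ ε)) ⟫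
    row-α : row α ≡ b
    row-α = begin
      b ℚ.* χ (α ⊕ β) (α ⊕ β) ℚ.+ ⟪ q′ , _ ⟫
        ≡⟨ cong₂ (λ x y → b ℚ.* x ℚ.+ y) (χ-≡ (α ⊕ β)) (⟪⟫-vanish q′ (All.map (χ-≢ ∘ ≺⇒≢ ∘ ⊕-monoʳ α) β≺q′)) ⟩
      b ℚ.* 1ℚ ℚ.+ 0ℚ
        ≡⟨ trans (ℚₚ.+-identityʳ _) (ℚₚ.*-identityʳ b) ⟩
      b ∎
    row-above : ∀ {γ} → α ≺ γ → row γ ≡ 0ℚ
    row-above {γ} α≺γ = ⟪⟫-vanish ((b , β) ∷ q′)
      (χ-≢ (≺⇒≢ (⊕-monoˡ β α≺γ)) ∷
       All.map (λ β≺ε → χ-≢ (≺⇒≢ (≺-trans (⊕-monoˡ β α≺γ) (⊕-monoʳ γ β≺ε)))) β≺q′)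
    ab≡0 : a ℚ.* b ≡ 0ℚ
    ab≡0 = begin
      a ℚ.* b
        ≡⟨ ℚₚ.+-identityʳ _ ⟨
      a ℚ.* b ℚ.+ 0ℚ
        ≡⟨ cong₂ (λ x y → a ℚ.* x ℚ.+ y) row-α (⟪⟫-vanish p′ (All.map row-above α≺p′)) ⟨
      ⟪ (a , α) ∷ p′ , row ⟫
        ≡⟨ p≡ row ⟩
      ⟪ p , row ⟫
        ≡⟨ ⟪⟫-congʳ p (λ γ → q≡ _) ⟩
      ⟪ p , (λ γ → ⟪ q , (λ ε → χ (α ⊕ β) (γ ⊕ ε)) ⟫) ⟫
        ≡⟨ ⟪⟫-*ₚ p q (χ (α ⊕ β)) ⟨
      ⟪ p *ₚ q , χ (α ⊕ β) ⟫
        ≡⟨ ⟪⟫-zero {p = p *ₚ q} pq≈0 _ ⟩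
      0ℚ ∎

  -- Substitution homomorphisms between polynomial rings.

  private
    module Ring {k : ℕ} where
      open CommutativeRing (polyRing k) public hiding (refl; sym; trans; zero)
      open Exp semiring public using (_^_; ^-homo-*; ^-congˡ)
      open CommutativeSemigroupProperties *-commutativeSemigroup public using (interchange)

  term : Monomial k → Poly k
  term α = (1ℚ , α) ∷ []

  constant : ℚ → Poly k
  constant a = (a , replicate _ 0) ∷ []

  power : (Fin k → Poly l) → Monomial k → Poly l
  power s []      = 1ₚ
  power s (j ∷ α) = s zero Ring.^ j *ₚ power (s ∘ suc) α

  substitute : (Fin k → Poly l) → Poly k → Poly l
  substitute s []            = 0ₚ
  substitute s ((a , α) ∷ p) = constant a *ₚ power s α +ₚ substitute s p

  ⟪⟫-constant : ∀ a (p : Poly k) h → ⟪ constant a *ₚ p , h ⟫ ≡ a ℚ.* ⟪ p , h ⟫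
  ⟪⟫-constant a p h = begin
    ⟪ constant a *ₚ p , h ⟫                              ≡⟨ ⟪⟫-*ₚ (constant a) p h ⟩
    a ℚ.* ⟪ p , (λ β → h (replicate _ 0 ⊕ β)) ⟫ ℚ.+ 0ℚ  ≡⟨ ℚₚ.+-identityʳ _ ⟩
    a ℚ.* ⟪ p , (λ β → h (replicate _ 0 ⊕ β)) ⟫         ≡⟨ cong (a ℚ.*_) (⟪⟫-congʳ p λ β → cong h (⊕-identityˡ β)) ⟩
    a ℚ.* ⟪ p , h ⟫                                      ∎
    where open ≡-Reasoning

  term-* : (α β : Monomial k) → term α *ₚ term β ≈ₚ term (α ⊕ β)
  term-* α β γ = refl

  power-cong : {s t : Fin k → Poly l} → (∀ i → s i ≈ₚ t i) → ∀ α → power s α ≈ₚ power t α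
  power-cong s≈t []      = λ γ → refl
  power-cong {s = s} {t} s≈t (j ∷ α) =
    *ₚ-cong {p = s zero Ring.^ j} {t zero Ring.^ j} {power (s ∘ suc) α} {power (t ∘ suc) α}
      (Ring.^-congˡ j (s≈t zero)) (power-cong (s≈t ∘ suc) α)

  power-⊕ : (s : Fin k → Poly l) → ∀ α β → power s (α ⊕ β) ≈ₚ power s α *ₚ power s β
  power-⊕ s []      []      = λ γ → sym (*ₚ-identityˡ 1ₚ γ)
  power-⊕ s (i ∷ α) (j ∷ β) = begin
    s zero ^ (i ℕ.+ j) *ₚ power (s ∘ suc) (α ⊕ β)
      ≈⟨ *ₚ-cong {p = s zero ^ (i ℕ.+ j)} {s zero ^ i *ₚ s zero ^ j} {power (s ∘ suc) (α ⊕ β)}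
             {power (s ∘ suc) α *ₚ power (s ∘ suc) β} (^-homo-* (s zero) i j) (power-⊕ (s ∘ suc) α β) ⟩
    (s zero ^ i *ₚ s zero ^ j) *ₚ (power (s ∘ suc) α *ₚ power (s ∘ suc) β)
      ≈⟨ interchange (s zero ^ i) (s zero ^ j) (power (s ∘ suc) α) (power (s ∘ suc) β) ⟩
    power s (i ∷ α) *ₚ power s (j ∷ β)
      ∎
    where
    open Ring
    open ≈-Reasoning setoid

  power-0 : (s : Fin k → Poly l) → power s (replicate k 0) ≈ₚ 1ₚ
  power-0 {zero}  s = λ γ → refl
  power-0 {suc k} s = λ γ → trans (*ₚ-identityˡ (power (s ∘ suc) (replicate k 0)) γ) (power-0 (s ∘ suc) γ)

  unit : Fin k → Monomial k
  unit i = replicate _ 0 [ i ]≔ 1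

  -- The map `ι` is there for the induction, which passes to the remaining variables by composing it
  -- with `0 ∷_`; the application takes the identity.
  power-term : (ι : Monomial k → Monomial l) → ι (replicate k 0) ≡ replicate l 0 →
    (∀ α β → ι (α ⊕ β) ≡ ι α ⊕ ι β) → ∀ α → power (term ∘ ι ∘ unit) α ≈ₚ term (ι α)
  power-term ι ι0 ι⊕ []      γ = cong (λ α → coeff (term α) γ) (sym ι0)
  power-term {suc k} ι ι0 ι⊕ (j ∷ α) = begin
    term (ι (1 ∷ replicate k 0)) ^ j *ₚ power (term ∘ ι ∘ (0 ∷_) ∘ unit) α
      ≈⟨ *ₚ-cong {p = term (ι (1 ∷ replicate k 0)) ^ j} {term (ι (j ∷ replicate k 0))}
             {power (term ∘ ι ∘ (0 ∷_) ∘ unit) α} {term (ι (0 ∷ α))} (head j)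
             (power-term (ι ∘ (0 ∷_)) ι0 (λ α β → ι⊕ (0 ∷ α) (0 ∷ β)) α) ⟩
    term (ι (j ∷ replicate k 0)) *ₚ term (ι (0 ∷ α))
      ≈⟨ term-* (ι (j ∷ replicate k 0)) (ι (0 ∷ α)) ⟩
    term (ι (j ∷ replicate k 0) ⊕ ι (0 ∷ α))
      ≡⟨ cong term (sym (ι⊕ (j ∷ replicate k 0) (0 ∷ α))) ⟩
    term (ι (j ℕ.+ 0 ∷ replicate k 0 ⊕ α))
      ≡⟨ cong₂ (λ i β → term (ι (i ∷ β))) (ℕₚ.+-identityʳ j) (⊕-identityˡ α) ⟩
    term (ι (j ∷ α))
      ∎
    where
    open Ring
    open ≈-Reasoning setoid
    head : ∀ j → term (ι (1 ∷ replicate k 0)) ^ j ≈ₚ term (ι (j ∷ replicate k 0))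
    head zero    γ = cong (λ α → coeff (term α) γ) (sym ι0)
    head (suc j) = begin
      term (ι (1 ∷ replicate k 0)) *ₚ term (ι (1 ∷ replicate k 0)) ^ j
        ≈⟨ *-congˡ {x = term (ι (1 ∷ replicate k 0))} {term (ι (1 ∷ replicate k 0)) ^ j}
             {term (ι (j ∷ replicate k 0))} (head j) ⟩
      term (ι (1 ∷ replicate k 0)) *ₚ term (ι (j ∷ replicate k 0))
        ≈⟨ term-* (ι (1 ∷ replicate k 0)) (ι (j ∷ replicate k 0)) ⟩
      term (ι (1 ∷ replicate k 0) ⊕ ι (j ∷ replicate k 0))
        ≡⟨ cong term (sym (ι⊕ (1 ∷ replicate k 0) (j ∷ replicate k 0))) ⟩
      term (ι (suc j ∷ replicate k 0 ⊕ replicate k 0))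
        ≡⟨ cong (λ β → term (ι (suc j ∷ β))) (⊕-identityˡ (replicate k 0)) ⟩
      term (ι (suc j ∷ replicate k 0))
        ∎

  module _ (s : Fin k → Poly l) where
    open Ring
    open ≈-Reasoning (setoid {l})

    -- Moving the substitution to the other side of the pairing reduces its compatibility with
    -- equality, sums, negation and products to the rules for the pairing.
    ⟪⟫-substitute : ∀ p h → ⟪ substitute s p , h ⟫ ≡ ⟪ p , (λ α → ⟪ power s α , h ⟫) ⟫
    ⟪⟫-substitute []            h = refl
    ⟪⟫-substitute ((a , α) ∷ p) h =
      trans (⟪⟫-++ (constant a *ₚ power s α) (substitute s p) h)
            (cong₂ ℚ._+_ (⟪⟫-constant a (power s α) h) (⟪⟫-substitute p h))

    substitute-cong : ∀ {p q} → p ≈ₚ q → substitute s p ≈ₚ substitute s q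
    substitute-cong {p} {q} p≈q = ⟪⟫-ext {p = substitute s p} {substitute s q} λ h →
      trans (⟪⟫-substitute p h) (trans (⟪⟫-congˡ {p = p} {q} p≈q _) (sym (⟪⟫-substitute q h)))

    substitute-+ : ∀ p q → substitute s (p +ₚ q) ≈ₚ substitute s p +ₚ substitute s q
    substitute-+ p q = ⟪⟫-ext {p = substitute s (p +ₚ q)} {substitute s p +ₚ substitute s q} λ h →
      trans (⟪⟫-substitute (p +ₚ q) h) (trans (⟪⟫-++ p q _) (sym
        (trans (⟪⟫-++ (substitute s p) (substitute s q) h) (cong₂ ℚ._+_ (⟪⟫-substitute p h) (⟪⟫-substitute q h)))))

    substitute-neg : ∀ p → substitute s (-ₚ p) ≈ₚ -ₚ substitute s p
    substitute-neg p = ⟪⟫-ext {p = substitute s (-ₚ p)} { -ₚ substitute s p} λ h →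
      trans (⟪⟫-substitute (-ₚ p) h) (trans (⟪⟫-neg p _) (sym
        (trans (⟪⟫-neg (substitute s p) h) (cong ℚ.-_ (⟪⟫-substitute p h)))))

    substitute-* : ∀ p q → substitute s (p *ₚ q) ≈ₚ substitute s p *ₚ substitute s q
    substitute-* p q = ⟪⟫-ext {p = substitute s (p *ₚ q)} {substitute s p *ₚ substitute s q} λ h → ≡R.begin
      ⟪ substitute s (p *ₚ q) , h ⟫
        ≡R.≡⟨ trans (⟪⟫-substitute (p *ₚ q) h) (⟪⟫-*ₚ p q _) ⟩
      ⟪ p , (λ α → ⟪ q , (λ β → ⟪ power s (α ⊕ β) , h ⟫) ⟫) ⟫
        ≡R.≡⟨ ⟪⟫-congʳ p (λ α → ⟪⟫-congʳ q λ β →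
               trans (⟪⟫-congˡ {p = power s (α ⊕ β)} {power s α *ₚ power s β} (power-⊕ s α β) h)
                     (⟪⟫-*ₚ (power s α) (power s β) h)) ⟩
      ⟪ p , (λ α → ⟪ q , (λ β → ⟪ power s α , (λ γ → ⟪ power s β , (λ ε → h (γ ⊕ ε)) ⟫) ⟫) ⟫) ⟫
        ≡R.≡⟨ ⟪⟫-congʳ p (λ α → trans (⟪⟫-swap q (power s α) _)
               (⟪⟫-congʳ (power s α) λ γ → sym (⟪⟫-substitute q _))) ⟩
      ⟪ p , (λ α → ⟪ power s α , (λ γ → ⟪ substitute s q , (λ ε → h (γ ⊕ ε)) ⟫) ⟫) ⟫
        ≡R.≡⟨ trans (⟪⟫-*ₚ (substitute s p) (substitute s q) h) (⟪⟫-substitute p _) ⟨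
      ⟪ substitute s p *ₚ substitute s q , h ⟫
        ≡R.∎
      where module ≡R = ≡-Reasoning

    substitute-constant : ∀ a → substitute s (constant a) ≈ₚ constant a
    substitute-constant a = begin
      constant a *ₚ power s (replicate k 0) +ₚ 0ₚ ≈⟨ +-identityʳ (constant a *ₚ power s (replicate k 0)) ⟩
      constant a *ₚ power s (replicate k 0)       ≈⟨ *-congˡ {x = constant a} {power s (replicate k 0)} {1ₚ} (power-0 s) ⟩
      constant a *ₚ 1ₚ                            ≈⟨ *-identityʳ (constant a) ⟩
      constant a                                  ∎

    substitute-term : ∀ α → substitute s (term α) ≈ₚ power s α
    substitute-term α = begin
      1ₚ *ₚ power s α +ₚ 0ₚ  ≈⟨ +-identityʳ (1ₚ *ₚ power s α) ⟩
      1ₚ *ₚ power s α        ≈⟨ *ₚ-identityˡ (power s α) ⟩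
      power s α              ∎

    substitute-^ : ∀ p j → substitute s (p ^ j) ≈ₚ substitute s p ^ j
    substitute-^ p zero    = substitute-constant 1ℚ
    substitute-^ p (suc j) = begin
      substitute s (p *ₚ p ^ j)             ≈⟨ substitute-* p (p ^ j) ⟩
      substitute s p *ₚ substitute s (p ^ j)
        ≈⟨ *-congˡ {x = substitute s p} {substitute s (p ^ j)} {substitute s p ^ j} (substitute-^ p j) ⟩
      substitute s p *ₚ substitute s p ^ j   ∎

    substitute-∑ : ∀ {m} (f : Fin m → Poly k) → substitute s (∑ f) ≈ₚ ∑ (substitute s ∘ f)
    substitute-∑ {zero}  f = λ γ → refl
    substitute-∑ {suc m} f = begin
      substitute s (f zero +ₚ ∑ (f ∘ suc))              ≈⟨ substitute-+ (f zero) (∑ (f ∘ suc)) ⟩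
      substitute s (f zero) +ₚ substitute s (∑ (f ∘ suc))
        ≈⟨ +-congˡ {x = substitute s (f zero)} {substitute s (∑ (f ∘ suc))}
             {∑ (substitute s ∘ f ∘ suc)} (substitute-∑ (f ∘ suc)) ⟩
      ∑ (substitute s ∘ f)                              ∎

  power-unit : (s : Fin k → Poly l) → ∀ i → power s (unit i) ≈ₚ s i
  power-unit {suc k} s zero = begin
    s zero *ₚ 1ₚ *ₚ power (s ∘ suc) (replicate k 0)
      ≈⟨ *ₚ-cong {p = s zero *ₚ 1ₚ} {s zero} {power (s ∘ suc) (replicate k 0)} {1ₚ}
           (*-identityʳ (s zero)) (power-0 (s ∘ suc)) ⟩
    s zero *ₚ 1ₚ                                    ≈⟨ *-identityʳ (s zero) ⟩
    s zero                                          ∎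
    where
    open Ring
    open ≈-Reasoning setoid
  power-unit {suc k} s (suc i) =
    λ γ → trans (*ₚ-identityˡ (power (s ∘ suc) (unit i)) γ) (power-unit (s ∘ suc) i γ)

  substitute-var : (s : Fin k → Poly l) → ∀ i → substitute s (var i) ≈ₚ s i
  substitute-var s i γ = trans (substitute-term s (unit i) γ) (power-unit s i γ)

  substitute-power : ∀ {k′} (t : Fin l → Poly k′) (s : Fin k → Poly l) α →
    substitute t (power s α) ≈ₚ power (substitute t ∘ s) α
  substitute-power t s []      = substitute-constant t 1ℚ
  substitute-power t s (j ∷ α) = begin
    substitute t (s zero ^ j *ₚ power (s ∘ suc) α)
      ≈⟨ substitute-* t (s zero ^ j) (power (s ∘ suc) α) ⟩
    substitute t (s zero ^ j) *ₚ substitute t (power (s ∘ suc) α)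
      ≈⟨ *ₚ-cong {p = substitute t (s zero ^ j)} {substitute t (s zero) ^ j}
             {substitute t (power (s ∘ suc) α)} {power (substitute t ∘ s ∘ suc) α}
             (substitute-^ t (s zero) j) (substitute-power t (s ∘ suc) α) ⟩
    power (substitute t ∘ s) (j ∷ α)
      ∎
    where
    open Ring
    open ≈-Reasoning setoid

  substitute-leftInverse : (s : Fin k → Poly l) (t : Fin l → Poly k) →
    (∀ i → substitute t (s i) ≈ₚ var i) → ∀ p → substitute t (substitute s p) ≈ₚ p
  substitute-leftInverse s t ts≈var []            = λ γ → refl
  substitute-leftInverse s t ts≈var ((a , α) ∷ p) = begin
    substitute t (constant a *ₚ power s α +ₚ substitute s p)
      ≈⟨ substitute-+ t (constant a *ₚ power s α) (substitute s p) ⟩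
    substitute t (constant a *ₚ power s α) +ₚ substitute t (substitute s p)
      ≈⟨ +-cong {x = substitute t (constant a *ₚ power s α)} {substitute t (constant a) *ₚ substitute t (power s α)}
                {substitute t (substitute s p)} {p} (substitute-* t (constant a) (power s α)) (substitute-leftInverse s t ts≈var p) ⟩
    substitute t (constant a) *ₚ substitute t (power s α) +ₚ p
      ≈⟨ +-congʳ {x = p} {substitute t (constant a) *ₚ substitute t (power s α)} {constant a *ₚ term α}
          (*ₚ-cong {p = substitute t (constant a)} {constant a} {substitute t (power s α)} {term α}
            (substitute-constant t a) monomial) ⟩
    constant a *ₚ term α +ₚ p
      ≡⟨ cong₂ (λ b β → (b , β) ∷ p) (ℚₚ.*-identityʳ a) (⊕-identityˡ α) ⟩
    (a , α) ∷ p
      ∎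
    where
    open Ring
    open ≈-Reasoning setoid
    monomial : substitute t (power s α) ≈ₚ term α
    monomial = begin
      substitute t (power s α)     ≈⟨ substitute-power t s α ⟩
      power (substitute t ∘ s) α   ≈⟨ power-cong ts≈var α ⟩
      power var α                  ≈⟨ power-term (λ α → α) refl (λ α β → refl) α ⟩
      term α                       ∎

  substitute-injective : (s : Fin k → Poly l) (t : Fin l → Poly k) →
    (∀ i → substitute t (s i) ≈ₚ var i) → ∀ {p} → substitute s p ≈ₚ 0ₚ → p ≈ₚ 0ₚ
  substitute-injective s t ts≈var {p} sp≈0 = begin
    p                           ≈⟨ substitute-leftInverse s t ts≈var p ⟨
    substitute t (substitute s p) ≈⟨ substitute-cong t {substitute s p} {0ₚ} sp≈0 ⟩
    0ₚ                          ∎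
    where
    open Ring
    open ≈-Reasoning setoid

open Polynomials

-- Fraction-free linear algebra over an integral domain.

record IntegralDomain : Set₁ where
  field
    commutativeRing : CommutativeRing 0ℓ 0ℓ
  open CommutativeRing commutativeRing public
  field
    1≉0            : ¬ 1# ≈ 0#
    -- Elimination has to find a nonzero pivot; with this decision it is constructive, and `cancel`
    -- replaces division by the pivot.
    _≟0            : ∀ x → Dec (x ≈ 0#)
    noZeroDivisors : ∀ x y → x * y ≈ 0# → x ≈ 0# ⊎ y ≈ 0#

  cancel : ∀ {x y} → ¬ x ≈ 0# → x * y ≈ 0# → y ≈ 0#
  cancel {x} {y} x≉0 xy≈0 = [ (λ x≈0 → contradiction x≈0 x≉0) , id ]′ (noZeroDivisors x y xy≈0)

module LinearAlgebra (D : IntegralDomain) where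
  open IntegralDomain D hiding (zero)
  open MonoidSum +-commutativeMonoid public using (sum; sum-cong-≋; sum-replicate-zero; ∑-distrib-+)
  open SemiringSum semiring public using (*-distribˡ-sum)
  open RingProperties ring
  open SemiringSolver commutativeSemiring using (solve; _:=_; _:+_; _:*_)
  open ≈-Reasoning setoid

  0*x+0*y : ∀ a b {x y} → x ≈ 0# → y ≈ 0# → a * x + b * y ≈ 0#
  0*x+0*y a b x≈0 y≈0 = begin
    a * _ + b * _   ≈⟨ +-cong (*-congˡ x≈0) (*-congˡ y≈0) ⟩
    a * 0# + b * 0# ≈⟨ +-cong (zeroʳ a) (zeroʳ b) ⟩
    0# + 0#         ≈⟨ +-identityˡ 0# ⟩
    0#              ∎

  x≈-y : ∀ {x y} → x + y ≈ 0# → x ≈ - y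
  x≈-y {x} {y} = +-inverseˡ-unique x y

  sum-vanish : ∀ {x : Fin k → Carrier} → (∀ i → x i ≈ 0#) → sum x ≈ 0#
  sum-vanish {k} x≈0 = trans (sum-cong-≋ x≈0) (sum-replicate-zero k)

  sum-linear : ∀ a b (x y : Fin k → Carrier) → sum (λ i → a * x i + b * y i) ≈ a * sum x + b * sum y
  sum-linear a b x y = begin
    sum (λ i → a * x i + b * y i)                   ≈⟨ ∑-distrib-+ (λ i → a * x i) (λ i → b * y i) ⟩
    sum (λ i → a * x i) + sum (λ i → b * y i)       ≈⟨ +-cong (*-distribˡ-sum a x) (*-distribˡ-sum b y) ⟨
    a * sum x + b * sum y                           ∎

  -- Linear forms are given by their values rather than by coefficients, so that restricting one to
  -- a parametrised subspace is mere composition (`pullback`).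
  record Form (I : Set) : Set where
    field
      ⟦_⟧     : (I → Carrier) → Carrier
      ⟦⟧-cong : ∀ {x y} → (∀ i → x i ≈ y i) → ⟦_⟧ x ≈ ⟦_⟧ y
      linear  : ∀ a b x y → ⟦_⟧ (λ i → a * x i + b * y i) ≈ a * ⟦_⟧ x + b * ⟦_⟧ y

    scale : ∀ a x → ⟦_⟧ (λ i → a * x i) ≈ a * ⟦_⟧ x
    scale a x = begin
      ⟦_⟧ (λ i → a * x i)              ≈⟨ ⟦⟧-cong (λ i → trans (+-congˡ (zeroˡ _)) (+-identityʳ _)) ⟨
      ⟦_⟧ (λ i → a * x i + 0# * x i)   ≈⟨ linear a 0# x x ⟩
      a * ⟦_⟧ x + 0# * ⟦_⟧ x           ≈⟨ trans (+-congˡ (zeroˡ _)) (+-identityʳ _) ⟩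
      a * ⟦_⟧ x                        ∎

    vanish : ∀ {x} → (∀ i → x i ≈ 0#) → ⟦_⟧ x ≈ 0#
    vanish {x} x≈0 = begin
      ⟦_⟧ x                  ≈⟨ ⟦⟧-cong (λ i → trans (x≈0 i) (sym (zeroˡ (x i)))) ⟩
      ⟦_⟧ (λ i → 0# * x i)   ≈⟨ scale 0# x ⟩
      0# * ⟦_⟧ x             ≈⟨ zeroˡ _ ⟩
      0#                     ∎

  open Form public

  pullback : ∀ {I J : Set} (L : (J → Carrier) → (I → Carrier)) →
    (∀ {x y} → (∀ j → x j ≈ y j) → ∀ i → L x i ≈ L y i) →
    (∀ a b x y i → L (λ j → a * x j + b * y j) i ≈ a * L x i + b * L y i) →
    Form I → Form J
  pullback L L-cong L-linear h = record
    { ⟦_⟧     = ⟦ h ⟧ ∘ L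
    ; ⟦⟧-cong = λ x≈y → ⟦⟧-cong h (L-cong x≈y)
    ; linear  = λ a b x y → trans (⟦⟧-cong h (L-linear a b x y)) (linear h a b (L x) (L y))
    }

  e₀ : Fin (suc k) → Carrier
  e₀ = 1# Vector.∷ λ _ → 0#

  extend : (Fin k → Carrier) → Fin (suc k) → Carrier
  extend x = 0# Vector.∷ x

  extend-cong : ∀ {x y : Fin k → Carrier} → (∀ i → x i ≈ y i) → ∀ i → extend x i ≈ extend y i
  extend-cong x≈y zero    = refl
  extend-cong x≈y (suc i) = x≈y i

  extend-linear : ∀ a b (x y : Fin k → Carrier) i → extend (λ j → a * x j + b * y j) i ≈ a * extend x i + b * extend y i
  extend-linear a b x y zero    = sym (0*x+0*y a b refl refl)
  extend-linear a b x y (suc i) = refl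

  decompose : ∀ a b (x : Fin k → Carrier) i → (a Vector.∷ λ j → b * x j) i ≈ a * e₀ i + b * extend x i
  decompose a b x zero    = sym (trans (+-cong (*-identityʳ a) (zeroʳ b)) (+-identityʳ a))
  decompose a b x (suc i) = sym (trans (+-congʳ (zeroʳ a)) (+-identityˡ _))

  δ : Fin k → Fin k → Carrier
  δ i j = if does (i Fin.≟ j) then 1# else 0#

  δ-≢ : {i j : Fin k} → i ≢ j → δ i j ≈ 0#
  δ-≢ {i = i} {j} i≢j rewrite dec-false (i Fin.≟ j) i≢j = refl

  δ-≡ : (i : Fin k) → δ i i ≈ 1#
  δ-≡ i rewrite dec-true (i Fin.≟ i) ≡.refl = refl

  sum-δ : ∀ (i : Fin k) (w : Fin k → Carrier) → sum (λ j → δ i j * w j) ≈ w i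
  sum-δ zero    w = trans (+-cong (*-identityˡ _) (sum-vanish (λ j → zeroˡ (w (suc j))))) (+-identityʳ _)
  sum-δ (suc i) w = trans (+-cong (zeroˡ _) (sum-δ i (w ∘ suc))) (+-identityˡ _)

  vanish-basis : ∀ (h : Form (Fin k)) → (∀ i → ⟦ h ⟧ (δ i) ≈ 0#) → ∀ x → ⟦ h ⟧ x ≈ 0#
  vanish-basis {zero}  h h≈0 x = vanish h λ ()
  vanish-basis {suc k} h h≈0 x = begin
    ⟦ h ⟧ x
      ≈⟨ ⟦⟧-cong h (λ { zero → refl ; (suc i) → sym (*-identityˡ (x (suc i))) }) ⟩
    ⟦ h ⟧ (x zero Vector.∷ λ j → 1# * x (suc j))
      ≈⟨ ⟦⟧-cong h (decompose (x zero) 1# (x ∘ suc)) ⟩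
    ⟦ h ⟧ (λ i → x zero * e₀ i + 1# * extend (x ∘ suc) i)
      ≈⟨ linear h (x zero) 1# e₀ (extend (x ∘ suc)) ⟩
    x zero * ⟦ h ⟧ e₀ + 1# * ⟦ h ⟧ (extend (x ∘ suc))
      ≈⟨ 0*x+0*y (x zero) 1#
           (trans (⟦⟧-cong h (λ { zero → refl ; (suc i) → refl })) (h≈0 zero))
           (vanish-basis (pullback extend extend-cong extend-linear h)
             (λ i → trans (⟦⟧-cong h (λ { zero → refl ; (suc j) → refl })) (h≈0 (suc i)))
             (x ∘ suc)) ⟩
    0#
      ∎

  dot : (Fin k → Carrier) → Form (Fin k)
  dot w = record
    { ⟦_⟧     = λ x → sum (λ i → x i * w i)
    ; ⟦⟧-cong = λ x≈y → sum-cong-≋ (λ i → *-congʳ (x≈y i))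
    ; linear  = λ a b x y → begin
        sum (λ i → (a * x i + b * y i) * w i)
          ≈⟨ sum-cong-≋ (λ i → solve 5
               (λ a b x y w → (a :* x :+ b :* y) :* w := a :* (x :* w) :+ b :* (y :* w)) refl a b (x i) (y i) (w i)) ⟩
        sum (λ i → a * (x i * w i) + b * (y i * w i))
          ≈⟨ sum-linear a b (λ i → x i * w i) (λ i → y i * w i) ⟩
        a * sum (λ i → x i * w i) + b * sum (λ i → y i * w i)
          ∎
    }

  coordinate : ∀ {I : Set} → Carrier → I → Form I
  coordinate w i = record
    { ⟦_⟧     = λ x → w * x i
    ; ⟦⟧-cong = λ x≈y → *-congˡ (x≈y i)
    ; linear  = λ a b x y →
        solve 5 (λ a b x y w → w :* (a :* x :+ b :* y) := a :* (w :* x) :+ b :* (w :* y)) refl a b (x i) (y i) w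
    }

  total : ∀ {I : Set} → (Fin r → Form I) → Form I
  total h = record
    { ⟦_⟧     = λ x → sum (λ i → ⟦ h i ⟧ x)
    ; ⟦⟧-cong = λ x≈y → sum-cong-≋ (λ i → ⟦⟧-cong (h i) x≈y)
    ; linear  = λ a b x y → begin
        sum (λ i → ⟦ h i ⟧ (λ j → a * x j + b * y j))
          ≈⟨ sum-cong-≋ (λ i → linear (h i) a b x y) ⟩
        sum (λ i → a * ⟦ h i ⟧ x + b * ⟦ h i ⟧ y)
          ≈⟨ sum-linear a b (λ i → ⟦ h i ⟧ x) (λ i → ⟦ h i ⟧ y) ⟩
        a * sum (λ i → ⟦ h i ⟧ x) + b * sum (λ i → ⟦ h i ⟧ y)
          ∎
    }

  System : ℕ → Set
  System k = List (Form (Fin k))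

  Solution : System k → (Fin k → Carrier) → Set
  Solution H x = All (λ h → ⟦ h ⟧ x ≈ 0#) H

  Trivial : System k → Set
  Trivial H = ∀ x → Solution H x → ∀ i → x i ≈ 0#

  Nontrivial : System k → Set
  Nontrivial {k} H = Σ[ x ∈ (Fin k → Carrier) ] (∃ λ i → ¬ x i ≈ 0#) × Solution H x

  -- `join` and `split` say that `H` is `pivot ∷ rest` up to order, in the form in which it is used:
  -- for properties of all equations.
  record Pivot (H : System (suc k)) (e : Fin (suc k) → Carrier) : Set₁ where
    field
      pivot     : Form (Fin (suc k))
      rest      : System (suc k)
      nonzero   : ¬ ⟦ pivot ⟧ e ≈ 0#
      length≡   : length H ≡ suc (length rest)
      join      : ∀ {P : Form (Fin (suc k)) → Set} → P pivot → All P rest → All P H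
      split     : ∀ {P : Form (Fin (suc k)) → Set} → All P H → P pivot × All P rest

  findPivot : ∀ (H : System (suc k)) e → Solution H e ⊎ Pivot H e
  findPivot []      e = inj₁ []
  findPivot (h ∷ H) e with ⟦ h ⟧ e ≟0
  ... | no h≉0 = inj₂ record
    { pivot = h ; rest = H ; nonzero = h≉0 ; length≡ = ≡.refl
    ; join = _∷_ ; split = λ { (p ∷ ps) → p , ps } }
  ... | yes h≈0 with findPivot H e
  ...   | inj₁ sol = inj₁ (h≈0 ∷ sol)
  ...   | inj₂ piv = inj₂ record
    { pivot = pivot ; rest = h ∷ rest ; nonzero = nonzero ; length≡ = ≡.cong suc length≡
    ; join = λ { p (q ∷ qs) → q ∷ join p qs }
    ; split = λ { (q ∷ ps) → let (p , qs) = split ps in p , q ∷ qs } }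
    where open Pivot piv

  -- Gaussian elimination of the first unknown. If every form vanishes at `e₀`, this vector is a
  -- solution; otherwise one equation is spent on expressing the first unknown through the others.
  -- Spending one equation per unknown gives the bound in the second case.
  solveSystem : ∀ (H : System k) → Nontrivial H ⊎ (Trivial H × k ≤ length H)
  solveSystem {zero}  H = inj₂ ((λ x _ ()) , z≤n)
  solveSystem {suc k} H with findPivot H e₀
  ... | inj₁ sol = inj₁ (e₀ , (zero , 1≉0) , sol)
  ... | inj₂ piv = reduce (solveSystem reduced)
    where
    open Pivot piv
    p : Carrier
    p = ⟦ pivot ⟧ e₀
    -- The solutions of the equation `pivot`, parametrised up to the factor p.
    lift : (Fin k → Carrier) → Fin (suc k) → Carrier
    lift x = (- ⟦ pivot ⟧ (extend x)) Vector.∷ λ i → p * x i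

    lift-cong : ∀ {x y} → (∀ i → x i ≈ y i) → ∀ i → lift x i ≈ lift y i
    lift-cong x≈y zero    = -‿cong (⟦⟧-cong pivot (extend-cong x≈y))
    lift-cong x≈y (suc i) = *-congˡ (x≈y i)

    lift-linear : ∀ a b x y i → lift (λ j → a * x j + b * y j) i ≈ a * lift x i + b * lift y i
    lift-linear a b x y (suc i) =
      solve 5 (λ p a b x y → p :* (a :* x :+ b :* y) := a :* (p :* x) :+ b :* (p :* y)) refl p a b (x i) (y i)
    lift-linear a b x y zero    = begin
      - ⟦ pivot ⟧ (extend (λ j → a * x j + b * y j))
        ≈⟨ -‿cong (trans (⟦⟧-cong pivot (extend-linear a b x y)) (linear pivot a b (extend x) (extend y))) ⟩
      - (a * ⟦ pivot ⟧ (extend x) + b * ⟦ pivot ⟧ (extend y))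
        ≈⟨ -‿+-comm _ _ ⟨
      - (a * ⟦ pivot ⟧ (extend x)) - b * ⟦ pivot ⟧ (extend y)
        ≈⟨ +-cong (-‿distribʳ-* a _) (-‿distribʳ-* b _) ⟩
      a * - ⟦ pivot ⟧ (extend x) + b * - ⟦ pivot ⟧ (extend y)
        ∎

    pivot-lift : ∀ x → ⟦ pivot ⟧ (lift x) ≈ 0#
    pivot-lift x = begin
      ⟦ pivot ⟧ (lift x)                                          ≈⟨ ⟦⟧-cong pivot (decompose _ p x) ⟩
      ⟦ pivot ⟧ (λ i → - ⟦ pivot ⟧ (extend x) * e₀ i + p * extend x i) ≈⟨ linear pivot _ p e₀ (extend x) ⟩
      - ⟦ pivot ⟧ (extend x) * p + p * ⟦ pivot ⟧ (extend x)       ≈⟨ +-cong (-‿distribˡ-* _ p) (*-comm _ p) ⟨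
      - (⟦ pivot ⟧ (extend x) * p) + ⟦ pivot ⟧ (extend x) * p     ≈⟨ -‿inverseˡ _ ⟩
      0#                                                          ∎

    lift-tail : ∀ x → ⟦ pivot ⟧ x ≈ 0# → ∀ i → lift (x ∘ suc) i ≈ p * x i
    lift-tail x sol (suc i) = refl
    lift-tail x sol zero    = sym (x≈-y (begin
      p * x zero + ⟦ pivot ⟧ (extend (x ∘ suc))
        ≈⟨ +-cong (*-comm p _) (sym (*-identityˡ _)) ⟩
      x zero * p + 1# * ⟦ pivot ⟧ (extend (x ∘ suc))
        ≈⟨ linear pivot (x zero) 1# e₀ (extend (x ∘ suc)) ⟨
      ⟦ pivot ⟧ (λ i → x zero * e₀ i + 1# * extend (x ∘ suc) i)
        ≈⟨ ⟦⟧-cong pivot (λ i → trans (sym (decompose (x zero) 1# (x ∘ suc) i)) (recombine i)) ⟩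
      ⟦ pivot ⟧ x
        ≈⟨ sol ⟩
      0# ∎))
      where
      recombine : ∀ i → (x zero Vector.∷ λ j → 1# * x (suc j)) i ≈ x i
      recombine zero    = refl
      recombine (suc i) = *-identityˡ (x (suc i))

    reduced : System k
    reduced = map (pullback lift lift-cong lift-linear) rest

    reduce : Nontrivial reduced ⊎ (Trivial reduced × k ≤ length reduced) →
             Nontrivial H ⊎ (Trivial H × suc k ≤ length H)
    reduce (inj₁ (x , (i , xi≉0) , sol)) =
      inj₁ (lift x , (suc i , λ pxi≈0 → xi≉0 (cancel nonzero pxi≈0)) , join (pivot-lift x) (Allₚ.map⁻ sol))
    reduce (inj₂ (triv , k≤)) = inj₂ (trivial , bound)
      where
      bound : suc k ≤ length H
      bound = ≡.subst (suc k ≤_) (≡.sym length≡) (s≤s (≡.subst (k ≤_) (Listₚ.length-map _ rest) k≤))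
      trivial : Trivial H
      trivial x sol = λ
        { zero    → cancel nonzero (trans (sym (lift-tail x pivot≈0 zero))
                      (trans (-‿cong (vanish pivot (λ { zero → refl ; (suc i) → tail≈0 i }))) -0#≈0#))
        ; (suc i) → tail≈0 i }
        where
        pivot≈0 = proj₁ (split {λ h → ⟦ h ⟧ x ≈ 0#} sol)
        tail≈0 : ∀ i → x (suc i) ≈ 0#
        tail≈0 = triv (x ∘ suc) (Allₚ.map⁺ (All.map
          (λ {h} hx≈0 → trans (⟦⟧-cong h (lift-tail x pivot≈0)) (trans (scale h p x) (trans (*-congˡ hx≈0) (zeroʳ p))))
          (proj₂ (split {λ h → ⟦ h ⟧ x ≈ 0#} sol))))

  underdetermined : ∀ (H : System k) → suc (length H) ≤ k → Nontrivial H
  underdetermined H len<k with solveSystem H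
  ... | inj₁ nontriv    = nontriv
  ... | inj₂ (_ , k≤len) = contradiction (ℕₚ.≤-trans len<k k≤len) (ℕₚ.<-irrefl ≡.refl)
    where import Data.Nat.Properties as ℕₚ

  -- If H has a nonzero solution z, it is unique up to scalars since the total does
  -- not vanish on it; so any form not vanishing at z may replace the total.
  replaceTotal : ∀ (H : System k) (h : Fin (suc r) → Form (Fin k)) → Trivial (total h ∷ H) →
    ∃ λ i → Trivial (h i ∷ H)
  replaceTotal H h triv with solveSystem H
  ... | inj₂ (trivH , _) = zero , λ { x (_ ∷ sol) → trivH x sol }
  ... | inj₁ (z , (j , zj≉0) , solz) with Finₚ.any? (λ i → ¬? (⟦ h i ⟧ z ≟0))
  ...   | no none = contradiction
            (triv z (sum-vanish (λ i → decidable-stable (⟦ h i ⟧ z ≟0) (λ hi≉0 → none (i , hi≉0))) ∷ solz) j) zj≉0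
  ...   | yes (i , hiz≉0) = i , trivial
    where
    s : Carrier
    s = ⟦ total h ⟧ z
    s≉0 : ¬ s ≈ 0#
    s≉0 s≈0 = zj≉0 (triv z (s≈0 ∷ solz) j)
    trivial : Trivial (h i ∷ H)
    trivial x (hix≈0 ∷ solx) l = cancel s≉0 (begin
      s * x l                 ≈⟨ +-identityʳ _ ⟨
      s * x l + 0#            ≈⟨ +-congˡ (trans (*-congʳ -s′≈0) (zeroˡ (z l))) ⟨
      s * x l + - s′ * z l    ≈⟨ w≈0 l ⟩
      0#                      ∎)
      where
      s′ : Carrier
      s′ = ⟦ total h ⟧ x
      -- The combination of `x` and `z` on which the total vanishes; it also solves `H`, so it is
      -- zero. Evaluating `h i` on it leaves only the term with `z`, whence `s′` is zero, and then
      -- so is `s * x l`.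
      w : Fin _ → Carrier
      w l = s * x l + - s′ * z l
      w≈0 : ∀ l → w l ≈ 0#
      w≈0 = triv w
        ((begin
          ⟦ total h ⟧ w       ≈⟨ linear (total h) s (- s′) x z ⟩
          s * s′ + - s′ * s   ≈⟨ +-cong (*-comm s s′) (sym (-‿distribˡ-* s′ s)) ⟩
          s′ * s - s′ * s     ≈⟨ -‿inverseʳ _ ⟩
          0#                  ∎)
        ∷ All.zipWith (λ {g} (gx , gz) → trans (linear g s (- s′) x z) (0*x+0*y s (- s′) gx gz)) (solx , solz))
      -s′≈0 : - s′ ≈ 0#
      -s′≈0 = cancel hiz≉0 (begin
        ⟦ h i ⟧ z * - s′                   ≈⟨ *-comm _ _ ⟩
        - s′ * ⟦ h i ⟧ z                   ≈⟨ +-identityˡ _ ⟨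
        0# + - s′ * ⟦ h i ⟧ z              ≈⟨ +-congʳ (trans (*-congˡ hix≈0) (zeroʳ s)) ⟨
        s * ⟦ h i ⟧ x + - s′ * ⟦ h i ⟧ z   ≈⟨ linear (h i) s (- s′) x z ⟨
        ⟦ h i ⟧ w                          ≈⟨ vanish (h i) w≈0 ⟩
        0#                                 ∎)

  -- The totals are replaced one at a time; the summand chosen for one of them joins the fixed
  -- equations while the others are treated.
  distributeTotals : ∀ (H : System k) (h : Fin m → Fin (suc r) → Form (Fin k)) →
    Trivial (tabulate (total ∘ h) ++ H) →
    Σ[ f ∈ (Fin m → Fin (suc r)) ] Trivial (tabulate (λ j → h j (f j)) ++ H)
  distributeTotals {m = zero}  H h triv = (λ ()) , triv
  distributeTotals {m = suc m} H h triv =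
    let i , triv′ = replaceTotal (tabulate (total ∘ h ∘ suc) ++ H) (h zero) triv
        f , triv″ = distributeTotals (h zero i ∷ H) (h ∘ suc) λ x sol → triv′ x (rotate (tabulate (total ∘ h ∘ suc)) sol)
    in i Vector.∷ f , λ { x (p ∷ sol) → triv″ x (rotate⁻¹ (tabulate (λ j → h (suc j) (f j))) p sol) }
    where
    rotate : ∀ G {g} {x} → Solution (G ++ g ∷ H) x → Solution (g ∷ G ++ H) x
    rotate G sol with Allₚ.++⁻ G sol
    ... | solG , p ∷ solH = p ∷ Allₚ.++⁺ solG solH
    rotate⁻¹ : ∀ G {g} {x} → ⟦ g ⟧ x ≈ 0# → Solution (G ++ H) x → Solution (G ++ g ∷ H) x
    rotate⁻¹ G p sol = let solG , solH = Allₚ.++⁻ G sol in Allₚ.++⁺ solG (p ∷ solH)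

  module _ {r m : ℕ} where

    component : Fin r → (Fin (r ℕ.* m) → Carrier) → Fin m → Carrier
    component i x j = x (combine i j)

    block : Fin r → Form (Fin m) → Form (Fin (r ℕ.* m))
    block i = pullback (component i) (λ x≈y j → x≈y (combine i j)) (λ a b x y j → refl)

    onBlock : Fin r → (Fin m → Carrier) → Fin r × Fin m → Carrier
    onBlock i x (i′ , j) = if does (i Fin.≟ i′) then x j else 0#

    place : Fin r → (Fin m → Carrier) → Fin (r ℕ.* m) → Carrier
    place i x = onBlock i x ∘ remQuot m

    component-place : ∀ i x j → component i (place i x) j ≈ x j
    component-place i x j = trans (reflexive (≡.cong (onBlock i x) (Finₚ.remQuot-combine i j))) (on i j)
      where
      on : ∀ i j → onBlock i x (i , j) ≈ x j
      on i j rewrite dec-true (i Fin.≟ i) ≡.refl = refl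

    component-place-≢ : ∀ {i i′} x j → i ≢ i′ → component i′ (place i x) j ≈ 0#
    component-place-≢ {i} {i′} x j i≢i′ = trans (reflexive (≡.cong (onBlock i x) (Finₚ.remQuot-combine i′ j))) off
      where
      off : onBlock i x (i′ , j) ≈ 0#
      off rewrite dec-false (i Fin.≟ i′) i≢i′ = refl

  -- If the solution spaces of the systems L i, rescaled by the w2*[4+k]∸3≡s w i, are
  -- independent, then the coordinates can be distributed so that each solution of
  -- L i is determined by its coordinates in the i-th class.  (For subspaces whose
  -- dimensions add up to m this is the Laplace expansion of a nonzero determinant.)
  distributeCoordinates : ∀ (L : Fin (suc r) → System m) (w : Fin (suc r) → Fin m → Carrier) →
    (∀ x → (∀ i → Solution (L i) (x i)) → (∀ j → sum (λ i → w i j * x i j) ≈ 0#) → ∀ i j → x i j ≈ 0#) →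
    Σ[ g ∈ (Fin m → Fin (suc r)) ]
      (∀ i x → Solution (L i) x → (∀ j → g j ≡ i → w i j * x j ≈ 0#) → ∀ j → x j ≈ 0#)
  distributeCoordinates {r = r} {m} L w independent =
    let g , triv = distributeTotals H h trivial in g , λ i x solx gx j →
      trans (sym (component-place i x j))
        (triv (place i x) (Allₚ.++⁺ (Allₚ.tabulate⁺ (class x gx)) (placed x solx)) (combine i j))
    where
    H : System (suc r ℕ.* m)
    H = concat (tabulate λ i → map (block i) (L i))
    -- The total of `h j` is the j-th coordinate of the rescaled sum of a tuple of solutions. The
    -- summand that survives in its place decides the class of `j`.
    h : Fin m → Fin (suc r) → Form (Fin (suc r ℕ.* m))
    h j i = block i (coordinate (w i j) j)
    trivial : Trivial (tabulate (total ∘ h) ++ H)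
    trivial x sol l = ≡.subst (λ l → x l ≈ 0#) (Finₚ.combine-remQuot {suc r} m l)
      (independent (λ i → component i x)
        (λ i → Allₚ.map⁻ {f = block i} (Allₚ.tabulate⁻ {f = λ i → map (block i) (L i)}
          (Allₚ.concat⁻ (proj₂ (Allₚ.++⁻ (tabulate (total ∘ h)) sol))) i))
        (Allₚ.tabulate⁻ (proj₁ (Allₚ.++⁻ (tabulate (total ∘ h)) sol)))
        (proj₁ (remQuot {suc r} m l)) (proj₂ (remQuot {suc r} m l)))
    placed : ∀ {i : Fin (suc r)} x → Solution (L i) x → Solution H (place i x)
    placed {i} x solx = Allₚ.concat⁺ (Allₚ.tabulate⁺ λ i′ → Allₚ.map⁺ {f = block i′} (all i′))
      where
      all : ∀ i′ → All (λ f → ⟦ f ⟧ (component i′ (place i x)) ≈ 0#) (L i′)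
      all i′ with i Fin.≟ i′
      ... | yes ≡.refl = All.map (λ {f} fx≈0 → trans (⟦⟧-cong f (component-place i x)) fx≈0) solx
      ... | no i≢i′    = All.tabulate (λ {f} _ → vanish f (λ j → component-place-≢ x j i≢i′))
    class : ∀ {i} {g : Fin m → Fin (suc r)} x → (∀ j → g j ≡ i → w i j * x j ≈ 0#) →
      ∀ j → ⟦ h j (g j) ⟧ (place i x) ≈ 0#
    class {i} {g} x gx j with i Fin.≟ g j
    ... | yes ≡.refl = trans (*-congˡ (component-place i x j)) (gx j ≡.refl)
    ... | no i≢gj    = trans (*-congˡ (component-place-≢ x j i≢gj)) (zeroʳ _)

-- Complements of edge sets as lists of equations to impose.

missing : Subset m → List (Fin m)
missing []            = []
missing (inside  ∷ T) = map suc (missing T)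
missing (outside ∷ T) = zero ∷ map suc (missing T)

length-missing : (T : Subset m) → length (missing T) ℕ.+ ∣ T ∣ ≡ m
length-missing []            = ≡.refl
length-missing (inside  ∷ T) =
  ≡.trans (ℕₚ.+-suc _ ∣ T ∣) (≡.cong suc (≡.trans (≡.cong (ℕ._+ ∣ T ∣) (Listₚ.length-map suc (missing T))) (length-missing T)))
length-missing (outside ∷ T) =
  ≡.cong suc (≡.trans (≡.cong (ℕ._+ ∣ T ∣) (Listₚ.length-map suc (missing T))) (length-missing T))

length-missing-< : (T : Subset m) → k ℕ.< ∣ T ∣ → length (missing T) ℕ.+ k ℕ.< m
length-missing-< {m} {k} T k<∣T∣ = begin
  suc (length (missing T) ℕ.+ k)   ≡⟨ ℕₚ.+-suc _ k ⟨
  length (missing T) ℕ.+ suc k     ≤⟨ ℕₚ.+-monoʳ-≤ (length (missing T)) k<∣T∣ ⟩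
  length (missing T) ℕ.+ ∣ T ∣     ≡⟨ length-missing T ⟩
  m                                ∎
  where open ℕₚ.≤-Reasoning

x∉p-x : ∀ (p : Subset m) x → x ∉ p ∖ x
x∉p-x (_ ∷ p) (suc x) (there x∈p-x) = x∉p-x p x x∈p-x

∉⇒∈missing : (T : Subset m) → ∀ {f} → f ∉ T → f ∈ˡ missing T
∉⇒∈missing (inside  ∷ T) {zero}  f∉T = contradiction here f∉T
∉⇒∈missing (inside  ∷ T) {suc f} f∉T = ∈-map⁺ suc (∉⇒∈missing T (f∉T ∘ there))
∉⇒∈missing (outside ∷ T) {zero}  f∉T = here ≡.refl
∉⇒∈missing (outside ∷ T) {suc f} f∉T = there (∈-map⁺ suc (∉⇒∈missing T (f∉T ∘ there)))

missing-∉ : (T : Subset m) → All (_∉ T) (missing T)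
missing-∉ []            = []
missing-∉ (inside  ∷ T) = Allₚ.map⁺ (All.map (λ { f∉T (there f∈T) → f∉T f∈T }) (missing-∉ T))
missing-∉ (outside ∷ T) = (λ ()) ∷ Allₚ.map⁺ (All.map (λ { f∉T (there f∈T) → f∉T f∈T }) (missing-∉ T))

-- Stresses, virtual work and the rank bound in the plane.

module Frameworks (D : IntegralDomain) where
  open IntegralDomain D hiding (zero)
  open LinearAlgebra D public
  open RingProperties ring
  open SemiringSolver commutativeSemiring using (solve; _:=_; _:+_; _:*_; con)
  open ≈-Reasoning setoid

  difference-linear : ∀ a b x y x′ y′ → (a * x + b * y) - (a * x′ + b * y′) ≈ a * (x - x′) + b * (y - y′)
  difference-linear a b x y x′ y′ = begin
    (a * x + b * y) - (a * x′ + b * y′)         ≈⟨ +-congˡ (-‿+-comm _ _) ⟨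
    (a * x + b * y) + (- (a * x′) - b * y′)     ≈⟨ +-congˡ (+-cong (-‿distribʳ-* a x′) (-‿distribʳ-* b y′)) ⟩
    (a * x + b * y) + (a * - x′ + b * - y′)     ≈⟨ solve 6
        (λ a b x y x′ y′ → (a :* x :+ b :* y) :+ (a :* x′ :+ b :* y′) := a :* (x :+ x′) :+ b :* (y :+ y′))
        refl a b x y (- x′) (- y′) ⟩
    a * (x - x′) + b * (y - y′)                 ∎

  cross-cancel : ∀ x y → x * y + - y * x ≈ 0#
  cross-cancel x y = begin
    x * y + - y * x    ≈⟨ +-cong (*-comm x y) (sym (-‿distribˡ-* y x)) ⟩
    y * x - y * x      ≈⟨ -‿inverseʳ _ ⟩
    0#                 ∎

  δ-difference : {i j : Fin k} → i ≢ j → δ i i - δ i j ≈ 1#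
  δ-difference {i = i} {j} i≢j = begin
    δ i i - δ i j  ≈⟨ +-cong (δ-≡ i) (-‿cong (δ-≢ {i = i} {j} i≢j)) ⟩
    1# - 0#        ≈⟨ +-congˡ -0#≈0# ⟩
    1# + 0#        ≈⟨ +-identityʳ 1# ⟩
    1#             ∎

  -- Every φ is, up to the factor X j - X i, the sum of a multiple of X and of a
  -- function taking equal values at i and j.
  vanish-balanced : ∀ {I : Set} (h : Form I) (X : I → Carrier) (i j : I) → ¬ X j - X i ≈ 0# →
    ⟦ h ⟧ X ≈ 0# → (∀ φ → φ j - φ i ≈ 0# → ⟦ h ⟧ φ ≈ 0#) → ∀ φ → ⟦ h ⟧ φ ≈ 0#
  vanish-balanced h X i j X≉ hX≈0 h≈0 φ = cancel X≉ (begin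
    (X j - X i) * ⟦ h ⟧ φ
      ≈⟨ +-identityʳ _ ⟨
    (X j - X i) * ⟦ h ⟧ φ + 0#
      ≈⟨ +-congˡ (trans (*-congˡ hX≈0) (zeroʳ _)) ⟨
    (X j - X i) * ⟦ h ⟧ φ + - (φ j - φ i) * ⟦ h ⟧ X
      ≈⟨ linear h _ _ φ X ⟨
    ⟦ h ⟧ (λ l → (X j - X i) * φ l + - (φ j - φ i) * X l)
      ≈⟨ h≈0 _ (trans (difference-linear _ _ _ _ _ _) (cross-cancel (X j - X i) (φ j - φ i))) ⟩
    0#
      ∎)

  one : ∀ {I : Set} → I → Carrier
  one _ = 1#

  vanish-shifted : ∀ {I : Set} (h : Form I) → ⟦ h ⟧ one ≈ 0# → ∀ φ a → ⟦ h ⟧ (λ i → φ i - a) ≈ 0# → ⟦ h ⟧ φ ≈ 0#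
  vanish-shifted h h1≈0 φ a h≈0 = begin
    ⟦ h ⟧ φ
      ≈⟨ ⟦⟧-cong h (λ i → split (φ i)) ⟩
    ⟦ h ⟧ (λ i → 1# * (φ i - a) + a * 1#)
      ≈⟨ linear h 1# a (λ i → φ i - a) one ⟩
    1# * ⟦ h ⟧ (λ i → φ i - a) + a * ⟦ h ⟧ one
      ≈⟨ 0*x+0*y 1# a h≈0 h1≈0 ⟩
    0#
      ∎
    where
    split : ∀ x → x ≈ 1# * (x - a) + a * 1#
    split x = begin
      x                      ≈⟨ +-identityʳ x ⟨
      x + 0#                 ≈⟨ +-congˡ (-‿inverseˡ a) ⟨
      x + (- a + a)          ≈⟨ +-assoc x (- a) a ⟨
      x - a + a              ≈⟨ +-cong (*-identityˡ _) (*-identityʳ a) ⟨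
      1# * (x - a) + a * 1#  ∎

  -- As `h` kills constants, `φ` may be shifted to vanish at vertex 0; the other indicators span all
  -- such functions.
  vanish-except₁ : ∀ (h : Form (Fin (suc n))) → ⟦ h ⟧ one ≈ 0# → (∀ i → ⟦ h ⟧ (δ (suc i)) ≈ 0#) → ∀ φ → ⟦ h ⟧ φ ≈ 0#
  vanish-except₁ h h1≈0 hδ≈0 φ = vanish-shifted h h1≈0 φ (φ zero) (begin
    ⟦ h ⟧ (λ i → φ i - φ zero)
      ≈⟨ ⟦⟧-cong h (λ { zero → -‿inverseʳ _ ; (suc i) → refl }) ⟩
    ⟦ h ⟧ (extend (λ i → φ (suc i) - φ zero))
      ≈⟨ vanish-basis (pullback extend extend-cong extend-linear h)
           (λ i → trans (⟦⟧-cong h (λ { zero → refl ; (suc j) → refl })) (hδ≈0 i)) _ ⟩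
    0# ∎)

  -- The shift that makes `φ` vanish at vertex 0 makes it vanish at vertex 1 too.
  vanish-except₂ : ∀ (h : Form (Fin (suc (suc n)))) → ⟦ h ⟧ one ≈ 0# → (∀ i → ⟦ h ⟧ (δ (suc (suc i))) ≈ 0#) →
    ∀ φ → φ 1F - φ 0F ≈ 0# → ⟦ h ⟧ φ ≈ 0#
  vanish-except₂ h h1≈0 hδ≈0 φ φ≈ = vanish-shifted h h1≈0 φ (φ zero) (begin
    ⟦ h ⟧ (λ i → φ i - φ zero)
      ≈⟨ ⟦⟧-cong h (λ { zero → -‿inverseʳ _ ; (suc zero) → φ≈ ; (suc (suc i)) → refl }) ⟩
    ⟦ h ⟧ (extend (extend (λ i → φ (suc (suc i)) - φ zero)))
      ≈⟨ vanish-basis (pullback extend extend-cong extend-linear (pullback extend extend-cong extend-linear h))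
           (λ i → trans (⟦⟧-cong h (λ { zero → refl ; (suc zero) → refl ; (suc (suc j)) → refl })) (hδ≈0 i)) _ ⟩
    0# ∎)

  Supported : Subset m → (Fin m → Carrier) → Set
  Supported S c = ∀ f → f ∉ S → c f ≈ 0#

  module Stresses {n m : ℕ} (ends : Fin m → Fin n × Fin n) where

    Δ : (Fin n → Carrier) → Fin m → Carrier
    Δ φ f = φ (proj₂ (ends f)) - φ (proj₁ (ends f))

    -- The virtual work of the stress c of a one-dimensional framework X against the
    -- displacement φ; ω c X (δ v) is, up to sign, the force at v.
    ω : (Fin m → Carrier) → (Fin n → Carrier) → (Fin n → Carrier) → Carrier
    ω c X φ = sum (λ f → c f * (Δ X f * Δ φ f))

    workForm : (X φ : Fin n → Carrier) → Form (Fin m)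
    workForm X φ = dot (λ f → Δ X f * Δ φ f)

    Δ-cong : ∀ {φ ψ} → (∀ v → φ v ≈ ψ v) → ∀ f → Δ φ f ≈ Δ ψ f
    Δ-cong φ≈ψ f = +-cong (φ≈ψ _) (-‿cong (φ≈ψ _))

    Δ≈0⇒≈ : ∀ φ f → Δ φ f ≈ 0# → φ (proj₁ (ends f)) ≈ φ (proj₂ (ends f))
    Δ≈0⇒≈ φ f eq = sym (x∙y⁻¹≈ε⇒x≈y _ _ eq)

    testForm : (Fin m → Carrier) → (Fin n → Carrier) → Form (Fin n)
    testForm c X = record
      { ⟦_⟧     = ω c X
      ; ⟦⟧-cong = λ φ≈ψ → sum-cong-≋ (λ f → *-congˡ (*-congˡ (Δ-cong φ≈ψ f)))
      ; linear  = λ a b φ ψ → trans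
          (sum-cong-≋ (λ f → trans (*-congˡ (*-congˡ (difference-linear a b _ _ _ _)))
            (solve 6 (λ a b c x y z → c :* (x :* (a :* y :+ b :* z)) := a :* (c :* (x :* y)) :+ b :* (c :* (x :* z)))
              refl a b (c f) (Δ X f) (Δ φ f) (Δ ψ f))))
          (sum-linear a b (λ f → c f * (Δ X f * Δ φ f)) (λ f → c f * (Δ X f * Δ ψ f)))
      }

    -- This symmetry plays the part of the infinitesimal rotation: a stress in equilibrium in
    -- direction X does no work in direction Y against the displacement X.
    ω-comm : ∀ c X Y → ω c X Y ≈ ω c Y X
    ω-comm c X Y = sum-cong-≋ (λ f → *-congˡ (*-comm (Δ X f) (Δ Y f)))

    ω-congˡ : ∀ c {X Y} φ → (∀ v → X v ≈ Y v) → ω c X φ ≈ ω c Y φ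
    ω-congˡ c φ X≈Y = sum-cong-≋ (λ f → *-congˡ (*-congʳ (Δ-cong X≈Y f)))

    ω-linearˡ : ∀ c a b X Y φ → ω c (λ v → a * X v + b * Y v) φ ≈ a * ω c X φ + b * ω c Y φ
    ω-linearˡ c a b X Y φ = begin
      ω c (λ v → a * X v + b * Y v) φ  ≈⟨ ω-comm c (λ v → a * X v + b * Y v) φ ⟩
      ω c φ (λ v → a * X v + b * Y v)  ≈⟨ linear (testForm c φ) a b X Y ⟩
      a * ω c φ X + b * ω c φ Y        ≈⟨ +-cong (*-congˡ (ω-comm c φ X)) (*-congˡ (ω-comm c φ Y)) ⟩
      a * ω c X φ + b * ω c Y φ        ∎

    ω-one : ∀ c X → ω c X one ≈ 0#
    ω-one c X = sum-vanish {x = λ f → c f * (Δ X f * Δ one f)}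
      (λ f → trans (*-congˡ (trans (*-congˡ (-‿inverseʳ 1#)) (zeroʳ (Δ X f)))) (zeroʳ (c f)))

    -- The shape of `rigidityMatrix` is kept, so that over a polynomial ring the two agree by
    -- computation.
    row : (Fin n → Carrier) → Fin m → Fin n → Carrier
    row X f v = let (a , b) = ends f in
      if does (v Fin.≟ a) then X b - X a else if does (v Fin.≟ b) then X a - X b else 0#

    row≈ : ∀ X f v → row X f v ≈ - (Δ X f * Δ (δ v) f)
    row≈ X f v with proj₁ (ends f) | proj₂ (ends f)
    ... | a | b with v Fin.≟ a | v Fin.≟ b
    ...   | yes ≡.refl | yes ≡.refl = begin
      X v - X v                    ≈⟨ -‿inverseʳ (X v) ⟩
      0#                           ≈⟨ trans (-‿cong (zeroʳ _)) -0#≈0# ⟨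
      - ((X v - X v) * 0#)         ≈⟨ -‿cong (*-congˡ (-‿inverseʳ 1#)) ⟨
      - ((X v - X v) * (1# - 1#))  ∎
    ...   | yes ≡.refl | no _ = begin
      X b - X v                    ≈⟨ *-identityʳ _ ⟨
      (X b - X v) * 1#             ≈⟨ -‿involutive _ ⟨
      - - ((X b - X v) * 1#)       ≈⟨ -‿cong (-‿distribʳ-* _ 1#) ⟩
      - ((X b - X v) * - 1#)       ≈⟨ -‿cong (*-congˡ (+-identityˡ _)) ⟨
      - ((X b - X v) * (0# - 1#))  ∎
    ...   | no _ | yes ≡.refl = begin
      X a - X v                    ≈⟨ ⁻¹-anti-homo‿- (X v) (X a) ⟨
      - (X v - X a)                ≈⟨ -‿cong (*-identityʳ _) ⟨
      - ((X v - X a) * 1#)         ≈⟨ -‿cong (*-congˡ (trans (+-congˡ -0#≈0#) (+-identityʳ 1#))) ⟨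
      - ((X v - X a) * (1# - 0#))  ∎
    ...   | no _ | no _ = begin
      0#                           ≈⟨ trans (-‿cong (zeroʳ _)) -0#≈0# ⟨
      - ((X b - X a) * 0#)         ≈⟨ -‿cong (*-congˡ (-‿inverseʳ 0#)) ⟨
      - ((X b - X a) * (0# - 0#))  ∎

    row-work : ∀ c X v → sum (λ f → c f * row X f v) ≈ - ω c X (δ v)
    row-work c X v = begin
      sum (λ f → c f * row X f v)                     ≈⟨ sum-cong-≋ (λ f → trans (*-congˡ (row≈ X f v)) (sym (-‿distribʳ-* _ _))) ⟩
      sum (λ f → - (c f * (Δ X f * Δ (δ v) f)))       ≈⟨ sum-neg (λ f → c f * (Δ X f * Δ (δ v) f)) ⟩
      - ω c X (δ v)                                   ∎
      where
      sum-neg : ∀ {k} (x : Fin k → Carrier) → sum (λ i → - x i) ≈ - sum x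
      sum-neg {zero}  x = sym -0#≈0#
      sum-neg {suc k} x = trans (+-congˡ (sum-neg (x ∘ suc))) (-‿+-comm _ _)

    rows-dependent : ∀ c X → (∀ φ → ω c X φ ≈ 0#) → ∀ v → sum (λ f → c f * row X f v) ≈ 0#
    rows-dependent c X work v = trans (row-work c X v) (trans (-‿cong (work (δ v))) -0#≈0#)

    work-vanishes : ∀ c X → (∀ v → sum (λ f → c f * row X f v) ≈ 0#) → ∀ v → ω c X (δ v) ≈ 0#
    work-vanishes c X rows v = begin
      ω c X (δ v)                          ≈⟨ -‿involutive _ ⟨
      - - ω c X (δ v)                      ≈⟨ -‿cong (trans (sym (row-work c X v)) (rows v)) ⟩
      - 0#                                 ≈⟨ -0#≈0# ⟩
      0#                                   ∎

    -- The shear making X and Y constant along f, cleared of the denominator Δ X f.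
    shear : (X Y : Fin n → Carrier) → Fin m → Fin n → Carrier
    shear X Y f v = Δ X f * Y v + - Δ Y f * X v

    shear-normalised : ∀ X Y f → Δ X f ≈ 1# → Δ Y f ≈ 0# → ∀ v → shear X Y f v ≈ Y v
    shear-normalised X Y f X≈1 Y≈0 v = begin
      Δ X f * Y v + - Δ Y f * X v   ≈⟨ +-cong (*-congʳ X≈1) (*-congʳ (trans (-‿cong Y≈0) -0#≈0#)) ⟩
      1# * Y v + 0# * X v           ≈⟨ +-cong (*-identityˡ _) (zeroˡ _) ⟩
      Y v + 0#                      ≈⟨ +-identityʳ _ ⟩
      Y v                           ∎

    Δ-shear : ∀ X Y f → Δ (shear X Y f) f ≈ 0#
    Δ-shear X Y f = trans (difference-linear _ _ _ _ _ _) (cross-cancel (Δ X f) (Δ Y f))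

    ω-shear : ∀ c X Y f φ → ω c X φ ≈ 0# → ω c Y φ ≈ 0# → ω c (shear X Y f) φ ≈ 0#
    ω-shear c X Y f φ ωX ωY = trans (ω-linearˡ c _ _ Y X φ) (0*x+0*y _ _ ωY ωX)

    ω-shear⁻¹ : ∀ c X Y f φ → ¬ Δ X f ≈ 0# → ω c X φ ≈ 0# → ω c (shear X Y f) φ ≈ 0# → ω c Y φ ≈ 0#
    ω-shear⁻¹ c X Y f φ X≉ ωX ωS = cancel X≉ (begin
      Δ X f * ω c Y φ                          ≈⟨ +-identityʳ _ ⟨
      Δ X f * ω c Y φ + 0#                     ≈⟨ +-congˡ (trans (*-congˡ ωX) (zeroʳ _)) ⟨
      Δ X f * ω c Y φ + - Δ Y f * ω c X φ      ≈⟨ ω-linearˡ c _ _ Y X φ ⟨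
      ω c (shear X Y f) φ                      ≈⟨ ωS ⟩
      0#                                       ∎)

    -- Each direction has its own family of test displacements, because the rank bound uses fewer
    -- tests in one direction than in the other.
    equilibrium : Subset m → (X : Fin n → Carrier) → (Fin k → Fin n → Carrier) →
      (Y : Fin n → Carrier) → (Fin l → Fin n → Carrier) → System m
    equilibrium S X φ Y ψ =
      map (coordinate 1#) (missing S) ++ tabulate (workForm X ∘ φ) ++ tabulate (workForm Y ∘ ψ)

    length-equilibrium : ∀ S X (φ : Fin k → Fin n → Carrier) Y (ψ : Fin l → Fin n → Carrier) →
      length (equilibrium S X φ Y ψ) ≡ length (missing S) ℕ.+ (k ℕ.+ l)
    length-equilibrium S X φ Y ψ =
      ≡.trans (Listₚ.length-++ (map (coordinate 1#) (missing S))) (≡.cong₂ ℕ._+_ (Listₚ.length-map _ (missing S))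
        (≡.trans (Listₚ.length-++ (tabulate (workForm X ∘ φ)))
          (≡.cong₂ ℕ._+_ (Listₚ.length-tabulate (workForm X ∘ φ)) (Listₚ.length-tabulate (workForm Y ∘ ψ)))))

    equilibrium⁺ : ∀ S X (φ : Fin k → Fin n → Carrier) Y (ψ : Fin l → Fin n → Carrier) {c} →
      Supported S c → (∀ i → ω c X (φ i) ≈ 0#) → (∀ i → ω c Y (ψ i) ≈ 0#) → Solution (equilibrium S X φ Y ψ) c
    equilibrium⁺ S X φ Y ψ supp Xφ Yψ =
      Allₚ.++⁺ (Allₚ.map⁺ {f = coordinate 1#} (All.map (λ f∉S → trans (*-identityˡ _) (supp _ f∉S)) (missing-∉ S)))
        (Allₚ.++⁺ (Allₚ.tabulate⁺ {f = workForm X ∘ φ} Xφ) (Allₚ.tabulate⁺ {f = workForm Y ∘ ψ} Yψ))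

    equilibrium⁻ : ∀ S X (φ : Fin k → Fin n → Carrier) Y (ψ : Fin l → Fin n → Carrier) {c} →
      Solution (equilibrium S X φ Y ψ) c → Supported S c × (∀ i → ω c X (φ i) ≈ 0#) × (∀ i → ω c Y (ψ i) ≈ 0#)
    equilibrium⁻ S X φ Y ψ sol =
      let supp , forces = Allₚ.++⁻ (map (coordinate 1#) (missing S)) sol
          Xφ , Yψ = Allₚ.++⁻ (tabulate (workForm X ∘ φ)) forces
      in (λ f f∉S → trans (sym (*-identityˡ _)) (All.lookup (Allₚ.map⁻ {f = coordinate 1#} supp) (∉⇒∈missing S f∉S))) ,
         Allₚ.tabulate⁻ {f = workForm X ∘ φ} Xφ , Allₚ.tabulate⁻ {f = workForm Y ∘ ψ} Yψ

  -- With |V| = n + 2 the bound is 2|V| - 3. Translations save the test at one vertex in each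
  -- direction, and the symmetry of `ω` saves a second one in direction Y, where X separates the
  -- vertices 0 and 1. A larger `T` would leave fewer equations than unknowns, hence a nonzero
  -- stress.
  rank-bound : ∀ (ends : Fin m → Fin (suc (suc n)) × Fin (suc (suc n))) → let open Stresses ends in
    ∀ (X Y : Fin (suc (suc n)) → Carrier) → ¬ X 1F - X 0F ≈ 0# → ∀ (T : Subset m) →
    (∀ c → Supported T c → (∀ φ → ω c X φ ≈ 0#) → (∀ φ → ω c Y φ ≈ 0#) → ∀ f → c f ≈ 0#) →
    ∣ T ∣ ≤ suc (n ℕ.+ n)
  rank-bound {m} {n} ends X Y X≉ T independent with ∣ T ∣ ℕ.≤? suc (n ℕ.+ n)
  ... | yes ∣T∣≤ = ∣T∣≤
  ... | no ∣T∣≰ = contradiction (independent c supported X-work Y-work i) ci≉0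
    where
    open Stresses ends
    H : System m
    H = equilibrium T X (δ ∘ suc) Y (λ w → δ (suc (suc w)))
    short : suc (length H) ≤ m
    short = ≡.subst (ℕ._< m) (≡.sym (length-equilibrium T X (δ ∘ suc) Y (λ w → δ (suc (suc w)))))
              (length-missing-< T (ℕₚ.≰⇒> ∣T∣≰))
    nontrivial = underdetermined H short
    c = proj₁ nontrivial
    i = proj₁ (proj₁ (proj₂ nontrivial))
    ci≉0 = proj₂ (proj₁ (proj₂ nontrivial))
    forces = equilibrium⁻ T X (δ ∘ suc) Y (λ w → δ (suc (suc w))) (proj₂ (proj₂ nontrivial))
    supported = proj₁ forces
    X-work : ∀ φ → ω c X φ ≈ 0#
    X-work = vanish-except₁ (testForm c X) (ω-one c X) (proj₁ (proj₂ forces))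
    Y-work : ∀ φ → ω c Y φ ≈ 0#
    Y-work = vanish-balanced (testForm c Y) X 0F 1F X≉ (trans (ω-comm c Y X) (X-work Y))
      (vanish-except₂ (testForm c Y) (ω-one c Y) (proj₂ (proj₂ forces)))

  -- The stress spaces of a graph and of its contraction.

  module Partition {n m : ℕ} (ends : Fin m → Fin (suc n) × Fin (suc n)) where
    open Stresses ends

    -- The contraction enters only through `q` and a section of it. Displacements of G/e are treated
    -- as displacements of G that agree at the ends of e, and `section-q` factors these through `q`;
    -- thus all stresses are compared on the same edges and vertices.
    module Split
      (E : Subset m) (e : Fin m) (e∈E : e ∈ E)
      (q : Fin (suc n) → Fin n) (section : Fin n → Fin (suc n))
      (section-q : ∀ (φ : Fin (suc n) → Carrier) → Δ φ e ≈ 0# → ∀ v → φ (section (q v)) ≈ φ v)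
      (X₁ X₂ X₃ : Fin (suc n) → Carrier)
      (X₁e≉0 : ¬ Δ X₁ e ≈ 0#) (X₂e≈0 : Δ X₂ e ≈ 0#) (X₃e≈0 : Δ X₃ e ≈ 0#)
      (X₁≉0 : ∀ {f} → f ∈ E → ¬ Δ X₁ f ≈ 0#) (X₂≉0 : ∀ {f} → f ∈ E → f ≢ e → ¬ Δ X₂ f ≈ 0#)
      (independent : ∀ c → Supported E c → (∀ φ → ω c X₁ φ ≈ 0#) → (∀ φ → ω c X₂ φ ≈ 0#) →
        (∀ φ → ω c X₃ φ ≈ 0#) → ∀ f → c f ≈ 0#)
      where

      Balanced : (Fin (suc n) → Carrier) → Set
      Balanced φ = Δ φ e ≈ 0#

      vanish-along-e : ∀ c X → ω c X X₁ ≈ 0# → (∀ φ → Balanced φ → ω c X φ ≈ 0#) → ∀ φ → ω c X φ ≈ 0#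
      vanish-along-e c X = vanish-balanced (testForm c X) X₁ (proj₁ (ends e)) (proj₂ (ends e)) X₁e≉0

      -- A stress b of the contraction in directions 2 and 3 that is also one in direction 1 extends
      -- over e to a stress of the whole graph; the coefficient at e is determined by ω b′ X₁ X₁ ≈ 0.
      no-common-stress : ∀ b → Supported E b → b e ≈ 0# →
        (∀ φ → Balanced φ → ω b X₁ φ ≈ 0#) → (∀ φ → Balanced φ → ω b X₂ φ ≈ 0#) →
        (∀ φ → Balanced φ → ω b X₃ φ ≈ 0#) → ∀ f → b f ≈ 0#
      no-common-stress b suppb be≈0 b₁ b₂ b₃ = b≈0
        where
        t s : Carrier
        t = Δ X₁ e
        s = - ω b X₁ X₁
        -- Extending `b` itself would need the coefficient `- ω b X₁ X₁` divided by `t * t` at e;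
        -- multiplying through by `t * t` stays in the ring.
        b′ : Fin m → Carrier
        b′ f = t * t * b f + s * δ e f
        ω-b′ : ∀ X φ → ω b′ X φ ≈ t * t * ω b X φ + s * (Δ X e * Δ φ e)
        ω-b′ X φ = trans (linear (workForm X φ) (t * t) s b (δ e)) (+-congˡ (*-congˡ (sum-δ e (λ f → Δ X f * Δ φ f))))
        balanced : ∀ X → (∀ φ → Balanced φ → ω b X φ ≈ 0#) → ∀ φ → Balanced φ → ω b′ X φ ≈ 0#
        balanced X bX φ bal = trans (ω-b′ X φ) (0*x+0*y (t * t) s (bX φ bal) (trans (*-congˡ bal) (zeroʳ (Δ X e))))
        stress₁ : ∀ φ → ω b′ X₁ φ ≈ 0#
        stress₁ = vanish-along-e b′ X₁ (trans (ω-b′ X₁ X₁) (cross-cancel (t * t) (ω b X₁ X₁))) (balanced X₁ b₁)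
        -- In the other directions the test against `X₁` is, by the symmetry of `ω`, an instance of
        -- `stress₁`.
        stress : ∀ X → (∀ φ → Balanced φ → ω b X φ ≈ 0#) → ∀ φ → ω b′ X φ ≈ 0#
        stress X bX = vanish-along-e b′ X (trans (ω-comm b′ X X₁) (stress₁ X)) (balanced X bX)
        supported : Supported E b′
        supported f f∉E = 0*x+0*y (t * t) s (suppb f f∉E) (δ-≢ {i = e} {f} (λ { ≡.refl → f∉E e∈E }))
        b≈0 : ∀ f → b f ≈ 0#
        b≈0 f with e Fin.≟ f
        ... | yes ≡.refl = be≈0
        ... | no e≢f = cancel X₁e≉0 (cancel X₁e≉0 (begin
          t * (t * b f)               ≈⟨ *-assoc t t (b f) ⟨
          t * t * b f                 ≈⟨ +-identityʳ _ ⟨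
          t * t * b f + 0#            ≈⟨ +-congˡ (trans (*-congˡ (δ-≢ e≢f)) (zeroʳ s)) ⟨
          b′ f                        ≈⟨ independent b′ supported stress₁ (stress X₂ b₂) (stress X₃ b₃) f ⟩
          0#                          ∎))

      test : Fin n → Fin (suc n) → Carrier
      test z = δ z ∘ q

      balanced-work : ∀ c X → (∀ z → ω c X (test z) ≈ 0#) → ∀ φ → Balanced φ → ω c X φ ≈ 0#
      balanced-work c X cX φ bal = begin
        ω c X φ                  ≈⟨ ⟦⟧-cong (testForm c X) (section-q φ bal) ⟨
        ω c X (φ ∘ section ∘ q)  ≈⟨ vanish-basis
          (pullback (_∘ q) (λ x≈y i → x≈y (q i)) (λ a b x y i → refl) (testForm c X)) cX (φ ∘ section) ⟩
        0#                       ∎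

      ContractedStress PlaneStress : (Fin m → Carrier) → Set
      ContractedStress c = Supported (E ∖ e) c × (∀ z → ω c X₂ (test z) ≈ 0#) × (∀ z → ω c X₃ (test z) ≈ 0#)
      PlaneStress      c = Supported E c × (∀ v → ω c X₁ (δ v) ≈ 0#) × (∀ v → ω c X₂ (δ v) ≈ 0#)

      independent-stresses : ∀ a b c → ContractedStress a → ContractedStress b → PlaneStress c →
        (∀ f → Δ X₂ f * a f + (Δ X₁ f * b f + (Δ X₂ f * c f + 0#)) ≈ 0#) →
        (∀ f → a f ≈ 0#) × (∀ f → b f ≈ 0#) × (∀ f → c f ≈ 0#)
      independent-stresses a b c (suppa , a₂ , a₃) (suppb , b₂ , b₃) (suppc , c₁ , c₂) relation = a≈0 , b≈0 , c≈0
        where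
        E∖e⊆E : ∀ {f} → f ∉ E → f ∉ E ∖ e
        E∖e⊆E f∉E f∈E∖e = f∉E (p─q⊆p E _ f∈E∖e)
        e∉E∖e : e ∉ E ∖ e
        e∉E∖e = x∉p-x E e

        X₂-work : ∀ φ → ω c X₂ φ ≈ 0#
        X₂-work = vanish-basis (testForm c X₂) c₂
        X₁-work : ∀ φ → ω c X₁ φ ≈ 0#
        X₁-work = vanish-basis (testForm c X₁) c₁

        -- Multiplied by `Δ φ` and summed over the edges, the relation adds the works of `a` in
        -- direction 2, of `b` in direction 1 and of `c` in direction 2. The first and the last
        -- vanish.
        b₁ : ∀ φ → Balanced φ → ω b X₁ φ ≈ 0#
        b₁ φ bal = begin
          ω b X₁ φ                                   ≈⟨ +-identityʳ _ ⟨
          ω b X₁ φ + 0#                              ≈⟨ +-congˡ (X₂-work φ) ⟨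
          ω b X₁ φ + ω c X₂ φ                        ≈⟨ +-identityˡ _ ⟨
          0# + (ω b X₁ φ + ω c X₂ φ)                 ≈⟨ +-congʳ (balanced-work a X₂ a₂ φ bal) ⟨
          ω a X₂ φ + (ω b X₁ φ + ω c X₂ φ)
            ≈⟨ +-congˡ (∑-distrib-+ (λ f → b f * (Δ X₁ f * Δ φ f)) (λ f → c f * (Δ X₂ f * Δ φ f))) ⟨
          ω a X₂ φ + sum (λ f → b f * (Δ X₁ f * Δ φ f) + c f * (Δ X₂ f * Δ φ f))
            ≈⟨ ∑-distrib-+ (λ f → a f * (Δ X₂ f * Δ φ f)) (λ f → b f * (Δ X₁ f * Δ φ f) + c f * (Δ X₂ f * Δ φ f)) ⟨
          sum (λ f → a f * (Δ X₂ f * Δ φ f) + (b f * (Δ X₁ f * Δ φ f) + c f * (Δ X₂ f * Δ φ f)))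
            ≈⟨ sum-vanish (λ f → trans
                 (solve 6 (λ a b c x₁ x₂ y → a :* (x₂ :* y) :+ (b :* (x₁ :* y) :+ c :* (x₂ :* y)) :=
                                             (x₂ :* a :+ (x₁ :* b :+ (x₂ :* c :+ con 0))) :* y)
                   refl (a f) (b f) (c f) (Δ X₁ f) (Δ X₂ f) (Δ φ f))
                 (trans (*-congʳ (relation f)) (zeroˡ _))) ⟩
          0#                                         ∎

        b≈0 : ∀ f → b f ≈ 0#
        b≈0 = no-common-stress b (λ f f∉E → suppb f (E∖e⊆E f∉E)) (suppb e e∉E∖e) b₁
                (balanced-work b X₂ b₂) (balanced-work b X₃ b₃)

        a+c≈0 : ∀ {f} → f ∈ E → f ≢ e → a f + c f ≈ 0#
        a+c≈0 {f} f∈E f≢e = cancel (X₂≉0 f∈E f≢e) (begin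
          Δ X₂ f * (a f + c f)
            ≈⟨ solve 3 (λ a c x → x :* (a :+ c) := x :* a :+ (con 0 :+ (x :* c :+ con 0))) refl (a f) (c f) (Δ X₂ f) ⟩
          Δ X₂ f * a f + (0# + (Δ X₂ f * c f + 0#))               ≈⟨ +-congˡ (+-congʳ (trans (*-congˡ (b≈0 f)) (zeroʳ _))) ⟨
          Δ X₂ f * a f + (Δ X₁ f * b f + (Δ X₂ f * c f + 0#))     ≈⟨ relation f ⟩
          0#                                                      ∎)

        -- The test against `X₁` follows from `X₁-work` by symmetry. For balanced `φ` the work of
        -- `c` is opposite to that of `a`: the two cancel off e, and at e the factor `Δ X₃ e` is
        -- zero.
        X₃-work : ∀ φ → ω c X₃ φ ≈ 0#
        X₃-work = vanish-along-e c X₃ (trans (ω-comm c X₃ X₁) (X₁-work X₃)) λ φ bal → begin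
          ω c X₃ φ
            ≈⟨ +-identityˡ _ ⟨
          0# + ω c X₃ φ
            ≈⟨ +-congʳ (balanced-work a X₃ a₃ φ bal) ⟨
          ω a X₃ φ + ω c X₃ φ
            ≈⟨ ∑-distrib-+ (λ f → a f * (Δ X₃ f * Δ φ f)) (λ f → c f * (Δ X₃ f * Δ φ f)) ⟨
          sum (λ f → a f * (Δ X₃ f * Δ φ f) + c f * (Δ X₃ f * Δ φ f))
            ≈⟨ sum-vanish (λ f → trans (sym (distribʳ _ (a f) (c f))) (termwise φ f)) ⟩
          0# ∎
          where
          termwise : ∀ φ f → (a f + c f) * (Δ X₃ f * Δ φ f) ≈ 0#
          termwise φ f with f Fin.≟ e | f ∈? E
          ... | yes ≡.refl | _ = trans (*-congˡ (trans (*-congʳ X₃e≈0) (zeroˡ _))) (zeroʳ _)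
          ... | no f≢e | yes f∈E = trans (*-congʳ (a+c≈0 f∈E f≢e)) (zeroˡ _)
          ... | no f≢e | no f∉E = trans (*-congʳ (trans (+-cong (suppa f (E∖e⊆E f∉E)) (suppc f f∉E)) (+-identityˡ 0#))) (zeroˡ _)

        c≈0 : ∀ f → c f ≈ 0#
        c≈0 = independent c suppc X₁-work X₂-work X₃-work

        a≈0 : ∀ f → a f ≈ 0#
        a≈0 f with f ∈? (E ∖ e)
        ... | no f∉E∖e = suppa f f∉E∖e
        ... | yes f∈E∖e = begin
          a f           ≈⟨ +-identityʳ _ ⟨
          a f + 0#      ≈⟨ +-congˡ (c≈0 f) ⟨
          a f + c f     ≈⟨ a+c≈0 (p─q⊆p E _ f∈E∖e) (λ { ≡.refl → e∉E∖e f∈E∖e }) ⟩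
          0#            ∎

      partition : Σ[ g ∈ (Fin m → Fin 3) ]
        (∀ i → i ≢ 2F → ∀ c → ContractedStress c → (∀ f → f ∈ E ∖ e → g f ≡ i → c f ≈ 0#) → ∀ f → c f ≈ 0#) ×
        (∀ c → PlaneStress c → (∀ f → f ∈ E ∖ e → g f ≡ 2F → c f ≈ 0#) → ∀ f → c f ≈ 0#)
      partition =
        let g , determined = distributeCoordinates L w independentL
        in g , contracted determined , plane determined
        where
        contractedSystem planeSystem : System m
        contractedSystem = equilibrium (E ∖ e) X₂ test X₃ test
        planeSystem      = equilibrium E X₁ δ X₂ δ
        L : Fin 3 → System m
        L 0F = contractedSystem
        L 1F = contractedSystem
        L 2F = planeSystem
        -- Rescaling the second copy of the space of contracted stresses by Δ X₁ / Δ X₂ makes it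
        -- independent of the first.
        w : Fin 3 → Fin m → Carrier
        w 0F = Δ X₂
        w 1F = Δ X₁
        w 2F = Δ X₂
        independentL : ∀ x → (∀ i → Solution (L i) (x i)) → (∀ j → sum (λ i → w i j * x i j) ≈ 0#) → ∀ i j → x i j ≈ 0#
        independentL x sol relation =
          let x₀≈0 , x₁≈0 , x₂≈0 = independent-stresses (x 0F) (x 1F) (x 2F)
                (equilibrium⁻ (E ∖ e) X₂ test X₃ test (sol 0F)) (equilibrium⁻ (E ∖ e) X₂ test X₃ test (sol 1F))
                (equilibrium⁻ E X₁ δ X₂ δ (sol 2F)) relation
          in λ { 0F → x₀≈0 ; 1F → x₁≈0 ; 2F → x₂≈0 }
        Determined : (Fin m → Fin 3) → Set
        Determined g = ∀ i x → Solution (L i) x → (∀ j → g j ≡ i → w i j * x j ≈ 0#) → ∀ j → x j ≈ 0#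
        module _ {g : Fin m → Fin 3} (determined : Determined g) where
          contracted : ∀ i → i ≢ 2F → ∀ c → ContractedStress c → (∀ f → f ∈ E ∖ e → g f ≡ i → c f ≈ 0#) →
            ∀ f → c f ≈ 0#
          contracted i i≢2 c (suppc , c₂ , c₃) class = contracted′ i i≢2 class
            where
            solution : Solution contractedSystem c
            solution = equilibrium⁺ (E ∖ e) X₂ test X₃ test suppc c₂ c₃
            contracted′ : ∀ i → i ≢ 2F → (∀ f → f ∈ E ∖ e → g f ≡ i → c f ≈ 0#) → ∀ f → c f ≈ 0#
            w2*[4+k]∸3≡ed : ∀ {i} → (∀ f → f ∈ E ∖ e → g f ≡ i → c f ≈ 0#) → ∀ a f → g f ≡ i → a * c f ≈ 0#
            w2*[4+k]∸3≡ed class a f gf≡i with f ∈? (E ∖ e)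
            ... | yes f∈ = trans (*-congˡ (class f f∈ gf≡i)) (zeroʳ a)
            ... | no f∉  = trans (*-congˡ (suppc f f∉)) (zeroʳ a)
            contracted′ 0F _ class = determined 0F c solution (λ f → w2*[4+k]∸3≡ed class (Δ X₂ f) f)
            contracted′ 1F _ class = determined 1F c solution (λ f → w2*[4+k]∸3≡ed class (Δ X₁ f) f)
            contracted′ 2F i≢2 _   = contradiction ≡.refl i≢2
          plane : ∀ c → PlaneStress c → (∀ f → f ∈ E ∖ e → g f ≡ 2F → c f ≈ 0#) → ∀ f → c f ≈ 0#
          plane c (suppc , c₁ , c₂) class =
            determined 2F c (equilibrium⁺ E X₁ δ X₂ δ suppc c₁ c₂) w2*[4+k]∸3≡ed
            where
            w2*[4+k]∸3≡ed : ∀ f → g f ≡ 2F → Δ X₂ f * c f ≈ 0#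
            w2*[4+k]∸3≡ed f gf≡2 with f Fin.≟ e | f ∈? E
            -- A plane stress may be nonzero at e, but its weight there is zero, so the equation at
            -- e holds whatever class e has received.
            ... | yes ≡.refl | _ = trans (*-congʳ X₂e≈0) (zeroˡ _)
            ... | no f≢e | yes f∈E = trans (*-congˡ (class f (x∈p∧x≢y⇒x∈p-y f∈E f≢e) gf≡2)) (zeroʳ _)
            ... | no f≢e | no f∉E = trans (*-congˡ (suppc f f∉E)) (zeroʳ _)

-- Transport of work along ring homomorphisms.

module Transfer (D D′ : IntegralDomain) where
  private
    module D  = IntegralDomain D
    module D′ = IntegralDomain D′
    module F  = Frameworks D
    module F′ = Frameworks D′

  module _ {⟦_⟧ : D.Carrier → D′.Carrier} (hom : RingMorphisms.IsRingHomomorphism D.rawRing D′.rawRing ⟦_⟧) where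
    open RingMorphisms.IsRingHomomorphism hom
    open D′ using (_≈_; _+_; _*_; -_; _-_; trans; sym; refl; +-cong; *-cong; -‿cong; setoid)
    open ≈-Reasoning setoid

    difference-homo : ∀ x y → ⟦ x D.- y ⟧ ≈ ⟦ x ⟧ - ⟦ y ⟧
    difference-homo x y = trans (+-homo x (D.- y)) (+-cong refl (-‿homo y))

    sum-homo : ∀ (x : Fin k → D.Carrier) → ⟦ F.sum x ⟧ ≈ F′.sum (⟦_⟧ ∘ x)
    sum-homo {zero}  x = 0#-homo
    sum-homo {suc k} x = trans (+-homo (x zero) (F.sum (x ∘ suc))) (+-cong refl (sum-homo (x ∘ suc)))

    δ-homo : ∀ (v w : Fin n) → ⟦ F.δ v w ⟧ ≈ F′.δ v w
    δ-homo v w with v Fin.≟ w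
    ... | yes _ = 1#-homo
    ... | no _  = 0#-homo

    module _ (ends : Fin m → Fin n × Fin n) where
      private
        module S  = F.Stresses ends
        module S′ = F′.Stresses ends

      Δ-homo : ∀ {φ φ′} → (∀ v → ⟦ φ v ⟧ ≈ φ′ v) → ∀ f → ⟦ S.Δ φ f ⟧ ≈ S′.Δ φ′ f
      Δ-homo φ≈φ′ f = trans (difference-homo _ _) (+-cong (φ≈φ′ _) (-‿cong (φ≈φ′ _)))

      shear-homo : ∀ {X X′ Y Y′} → (∀ v → ⟦ X v ⟧ ≈ X′ v) → (∀ v → ⟦ Y v ⟧ ≈ Y′ v) →
        ∀ f v → ⟦ S.shear X Y f v ⟧ ≈ S′.shear X′ Y′ f v
      shear-homo {X} {X′} {Y} {Y′} X≈X′ Y≈Y′ f v = trans (+-homo _ _) (+-cong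
        (trans (*-homo (S.Δ X f) (Y v)) (*-cong (Δ-homo {X} {X′} X≈X′ f) (Y≈Y′ v)))
        (trans (*-homo (D.- S.Δ Y f) (X v)) (*-cong (trans (-‿homo _) (-‿cong (Δ-homo {Y} {Y′} Y≈Y′ f))) (X≈X′ v))))

      ω-homo : ∀ c {X X′ φ φ′} → (∀ v → ⟦ X v ⟧ ≈ X′ v) → (∀ v → ⟦ φ v ⟧ ≈ φ′ v) →
        ⟦ S.ω c X φ ⟧ ≈ S′.ω (⟦_⟧ ∘ c) X′ φ′
      ω-homo c {X} {X′} {φ} {φ′} X≈X′ φ≈φ′ = trans (sum-homo (λ f → c f D.* (S.Δ X f D.* S.Δ φ f)))
        (F′.sum-cong-≋ λ f → trans (*-homo (c f) (S.Δ X f D.* S.Δ φ f))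
          (*-cong refl (trans (*-homo (S.Δ X f) (S.Δ φ f)) (*-cong (Δ-homo {X} {X′} X≈X′ f) (Δ-homo {φ} {φ′} φ≈φ′ f)))))

      ω-vanish-homo : ∀ c {X X′} v → (∀ w → ⟦ X w ⟧ ≈ X′ w) → S.ω c X (F.δ v) D.≈ D.0# →
        S′.ω (⟦_⟧ ∘ c) X′ (F′.δ v) ≈ D′.0#
      ω-vanish-homo c {X} {X′} v X≈X′ ω≈0 =
        trans (sym (ω-homo c {X} {X′} {F.δ v} {F′.δ v} X≈X′ (δ-homo v))) (trans (⟦⟧-cong ω≈0) 0#-homo)

-- Generic coordinates as indeterminates, and their specialisations.

polyDomain : ℕ → IntegralDomain
polyDomain k = record
  { commutativeRing = polyRing k ; 1≉0 = 1ₚ≉0ₚ ; _≟0 = _≟0ₚ ; noZeroDivisors = *ₚ-noZeroDivisors }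

substituteHom : (s : Fin k → Poly l) →
  RingMorphisms.IsRingHomomorphism (IntegralDomain.rawRing (polyDomain k)) (IntegralDomain.rawRing (polyDomain l))
    (substitute s)
substituteHom s = record
  { isSemiringHomomorphism = record
    { isNearSemiringHomomorphism = record
      { +-isMonoidHomomorphism = record
        { isMagmaHomomorphism = record
          { isRelHomomorphism = record { cong = λ {p} {q} → substitute-cong s {p} {q} }
          ; homo = substitute-+ s
          }
        ; ε-homo = λ α → ≡.refl
        }
      ; *-homo = substitute-* s
      }
    ; 1#-homo = substitute-constant s 1ℚ
    }
  ; -‿homo = substitute-neg s
  }

unit-injective : {i j : Fin k} → unit i ≡ unit j → i ≡ j
unit-injective {i = i} {j} eq with i Fin.≟ j
... | yes i≡j = i≡j
... | no i≢j with () ← ≡.trans (≡.sym (Vecₚ.lookup∘updateAt i (replicate _ 0)))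
                       (≡.trans (≡.cong (λ α → lookup α i) eq)
                       (≡.trans (Vecₚ.lookup∘updateAt′ i j i≢j (replicate _ 0)) (Vecₚ.lookup-replicate i 0)))

var-distinct : {i j : Fin k} → i ≢ j → ¬ (var i -ₚ var j ≈ₚ 0ₚ)
var-distinct {i = i} {j} i≢j eq = ℚₚ.1≢0 (≡.trans (≡.sym value) (⟪⟫-zero {p = var i -ₚ var j} eq (χ (unit i))))
  where
  open ≡.≡-Reasoning
  value : ⟪ var i -ₚ var j , χ (unit i) ⟫ ≡ 1ℚ
  value = begin
    ⟪ var i -ₚ var j , χ (unit i) ⟫
      ≡⟨ ⟪⟫-++ (var i) (-ₚ var j) (χ (unit i)) ⟩
    ⟪ var i , χ (unit i) ⟫ ℚ.+ ⟪ -ₚ var j , χ (unit i) ⟫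
      ≡⟨ ≡.cong₂ ℚ._+_ (⟪⟫-term (unit i) (χ (unit i))) (⟪⟫-neg (var j) (χ (unit i))) ⟩
    χ (unit i) (unit i) ℚ.- ⟪ var j , χ (unit i) ⟫
      ≡⟨ ≡.cong₂ ℚ._-_ (χ-≡ (unit i)) (≡.trans (⟪⟫-term (unit j) (χ (unit i))) (χ-≢ (i≢j ∘ ≡.sym ∘ unit-injective))) ⟩
    1ℚ ℚ.- 0ℚ
      ∎

coord-distinct : ∀ (i : Fin d) {v w : Fin n} → v ≢ w → ¬ (coord d n i v -ₚ coord d n i w ≈ₚ 0ₚ)
coord-distinct i {v} {w} v≢w = var-distinct (v≢w ∘ Finₚ.combine-injectiveʳ i v i w)

placement : (Fin d → Fin n → Poly l) → Fin (d ℕ.* n) → Poly l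
placement {n = n} p = uncurry p ∘ remQuot n

substitute-coord : ∀ (p : Fin d → Fin n → Poly l) i v → substitute (placement p) (coord d n i v) ≈ₚ p i v
substitute-coord p i v α = ≡.trans (substitute-var (placement p) (combine i v) α)
  (≡.cong (λ (i , v) → coeff (p i v) α) (Finₚ.remQuot-combine i v))

-- This carries independence between placements: if the coefficients of a dependency vanish after
-- the substitution, they vanished before it.
placement-injective : (p : Fin d → Fin n → Poly l) (t : Fin l → Poly (d ℕ.* n)) →
  (∀ i v → substitute t (p i v) ≈ₚ coord d n i v) → ∀ {a} → substitute (placement p) a ≈ₚ 0ₚ → a ≈ₚ 0ₚ
placement-injective {d} {n} p t tp≈coord {a} = substitute-injective (placement p) t (λ j α →
  ≡.trans (uncurry tp≈coord (remQuot {d} n j) α) (≡.cong (λ j → coeff (var j) α) (Finₚ.combine-remQuot {d} n j))) {a}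

-- Row independence and minimal rigidity.

module _ (d : ℕ) {n : ℕ} where
  open Frameworks (polyDomain (d ℕ.* n))
  open IntegralDomain (polyDomain (d ℕ.* n)) using (0#; _≈_)

  independent⇒stressFree : ∀ (G : Graph n m) T → let open Stresses (ends G) in IndependentRows d G T →
    ∀ c → Supported T c → (∀ i φ → ω c (coord d n i) φ ≈ 0#) → ∀ f → c f ≈ 0#
  independent⇒stressFree G T independent c supported work =
    independent c supported (λ i → Stresses.rows-dependent (ends G) c (coord d n i) (work i))

  stressFree⇒independent : ∀ (G : Graph n m) T → let open Stresses (ends G) in
    (∀ c → Supported T c → (∀ i v → ω c (coord d n i) (δ v) ≈ 0#) → ∀ f → c f ≈ 0#) → IndependentRows d G T
  stressFree⇒independent G T stressFree c supported rows =
    stressFree c supported (λ i → Stresses.work-vanishes (ends G) c (coord d n i) (rows i))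

independent-bound : ∀ (G : Graph (suc (suc n)) m) T → IndependentRows 2 G T → ∣ T ∣ ≤ suc (n ℕ.+ n)
independent-bound {n} G T independent =
  Frameworks.rank-bound (polyDomain (2 ℕ.* suc (suc n))) (ends G) (coord 2 _ 0F) (coord 2 _ 1F)
    (coord-distinct {2} {suc (suc n)} 0F {1F} {0F} (λ ())) T
    λ c supported w₀ w₁ → independent⇒stressFree 2 G T independent c supported λ { 0F → w₀ ; 1F → w₁ }

-- Every rigid competitor on n vertices contains an independent set of this same size, so it cannot
-- have fewer edges.
minimallyRigid : ∀ d (G : Graph n m) → IndependentRows d G (edges G) → ∣ edges G ∣ ≡ d ℕ.* n ∸ (suc d C 2) →
  MinimallyRigid d G
minimallyRigid d G independent size =
  ((edges G , ⊆-refl , independent , size) ,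
   λ T T⊆E _ → ℕₚ.≤-trans (p⊆q⇒∣p∣≤∣q∣ T⊆E) (ℕₚ.≤-reflexive size)) ,
  λ { H ((T , T⊆H , _ , ∣T∣≡) , _) → ℕₚ.≤-trans (ℕₚ.≤-reflexive (≡.trans size (≡.sym ∣T∣≡))) (p⊆q⇒∣p∣≤∣q∣ T⊆H) }

⊆∧∣∣≥⇒≡ : {p q : Subset m} → p ⊆ q → ∣ q ∣ ≤ ∣ p ∣ → p ≡ q
⊆∧∣∣≥⇒≡ {p = p} {q} p⊆q ∣q∣≤∣p∣ = ⊆-antisym p⊆q λ {x} x∈q → [ id , (λ x∉p →
  contradiction (p⊂q⇒∣p∣<∣q∣ (p⊆q , x , x∈q , x∉p)) (ℕₚ.≤⇒≯ ∣q∣≤∣p∣)) ]′ (decide x)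
  where
  decide : ∀ x → x ∈ p ⊎ x ∉ p
  decide x with x ∈? p
  ... | yes x∈p = inj₁ x∈p
  ... | no x∉p  = inj₂ x∉p

-- The independent set `T` that witnesses the rank already spans a rigid graph; minimality against
-- this subgraph forces `T` to be all of the edges.
minimallyRigid⁻ : ∀ d (G : Graph n m) → MinimallyRigid d G →
  IndependentRows d G (edges G) × ∣ edges G ∣ ≡ d ℕ.* n ∸ (suc d C 2)
minimallyRigid⁻ d G (((T , T⊆E , independent , ∣T∣≡) , bound) , minimal) with
  ⊆∧∣∣≥⇒≡ T⊆E (minimal (spanning G T)
    ((T , ⊆-refl , independent , ∣T∣≡) , λ T′ T′⊆T → bound T′ (⊆-trans T′⊆T T⊆E)))
... | ≡.refl = independent , ∣T∣≡

open ≡ using (sym)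

-- Identifying the ends of an edge.

module _ {u v : Fin (suc n)} (v≢u : v ≢ u) where

  identify-punchIn : ∀ z → identify u v v≢u (punchIn v z) ≡ z
  identify-punchIn z with v Fin.≟ punchIn v z
  ... | yes v≡ = contradiction (sym v≡) (Finₚ.punchInᵢ≢i v z)
  ... | no v≢  = ≡.trans (Finₚ.punchOut-cong v ≡.refl) (Finₚ.punchOut-punchIn v)

  -- The section `punchIn v` represents the merged vertex by `u`, so going down and up again moves
  -- only `v`.
  punchIn-identify : ∀ w → (w ≡ v × punchIn v (identify u v v≢u w) ≡ u) ⊎ punchIn v (identify u v v≢u w) ≡ w
  punchIn-identify w with v Fin.≟ w
  ... | yes v≡w = inj₁ (sym v≡w , Finₚ.punchIn-punchOut v≢u)
  ... | no v≢w  = inj₂ (Finₚ.punchIn-punchOut v≢w)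

  identify-ends : identify u v v≢u u ≡ identify u v v≢u v
  identify-ends with v Fin.≟ u | v Fin.≟ v
  ... | yes v≡u | _       = contradiction v≡u v≢u
  ... | no _    | no v≢v  = contradiction ≡.refl v≢v
  ... | no v≢u  | yes _   = Finₚ.punchOut-cong v ≡.refl

  -- In a simple graph this prevents edges other than the contracted one from becoming loops.
  identify-injective : ∀ {a b} → identify u v v≢u a ≡ identify u v v≢u b → a ≡ b ⊎ SameEnds (a , b) (u , v)
  identify-injective {a} {b} eq with punchIn-identify a | punchIn-identify b
  ... | inj₁ (a≡v , _) | inj₁ (b≡v , _) = inj₁ (≡.trans a≡v (sym b≡v))
  ... | inj₁ (a≡v , a↦u) | inj₂ b↦b = inj₂ (inj₂ (a≡v , ≡.trans (sym b↦b) (≡.trans (≡.cong (punchIn v) (sym eq)) a↦u)))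
  ... | inj₂ a↦a | inj₁ (b≡v , b↦u) = inj₂ (inj₁ (≡.trans (sym a↦a) (≡.trans (≡.cong (punchIn v) eq) b↦u) , b≡v))
  ... | inj₂ a↦a | inj₂ b↦b = inj₁ (≡.trans (sym a↦a) (≡.trans (≡.cong (punchIn v) eq) b↦b))

-- Relating the generic placements in space and in the plane.

module _ {n m : ℕ} (G : Graph (suc n) m) (simple : Simple G) (independent : IndependentRows 3 G (edges G))
         {e : Fin m} (e∈E : e ∈ edges G) where
  private
    E : Subset m
    E = edges G
    u v : Fin (suc n)
    u = proj₁ (ends G e)
    v = proj₂ (ends G e)
    v≢u : v ≢ u
    v≢u = loopless simple e∈E ∘ sym
    q : Fin (suc n) → Fin n
    q = identify u v v≢u

    D D₂ D₂′ : IntegralDomain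
    D   = polyDomain (3 ℕ.* suc n)
    D₂  = polyDomain (2 ℕ.* suc n)
    D₂′ = polyDomain (2 ℕ.* n)
    module F   = Frameworks D
    module F₂′ = Frameworks D₂′
    module S   = F.Stresses (ends G)
    module S₂′ = F₂′.Stresses (ends G)
    module R   = IntegralDomain D
    module R₂′ = IntegralDomain D₂′

    x : Fin 3 → Fin (suc n) → Poly (3 ℕ.* suc n)
    x = coord 3 (suc n)

    X₂ X₃ : Fin (suc n) → Poly (3 ℕ.* suc n)
    X₂ = S.shear (x 0F) (x 1F) e
    X₃ = S.shear (x 0F) (x 2F) e

    x₀e≉0 : ¬ S.Δ (x 0F) e R.≈ R.0#
    x₀e≉0 = coord-distinct {3} {suc n} 0F {v} {u} v≢u

    -- The specialisation placing u and v at distance one on a line parallel to the first axis and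
    -- all other vertices in the plane through u orthogonal to it, which becomes the generic plane
    -- placement of the contraction.
    τ : Fin 3 → Fin (suc n) → Poly (2 ℕ.* n)
    τ 0F w = F₂′.δ v w
    τ 1F w = coord 2 n 0F (q w)
    τ 2F w = coord 2 n 1F (q w)

    T : Poly (3 ℕ.* suc n) → Poly (2 ℕ.* n)
    T = substitute (placement τ)

    T-hom = substituteHom (placement τ)

    T-x : ∀ i w → T (x i w) ≈ₚ τ i w
    T-x = substitute-coord τ

    -- Under `T` the edge e gets length one in the first direction and zero in direction `i`, so the
    -- shear leaves that direction as it is.
    T-shear : ∀ i j → (∀ w → τ i w ≡ coord 2 n j (q w)) → ∀ w → T (S.shear (x 0F) (x i) e w) ≈ₚ coord 2 n j (q w)
    T-shear i j τi≡ w α = begin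
      coeff (T (S.shear (x 0F) (x i) e w)) α
        ≡⟨ Transfer.shear-homo D D₂′ T-hom (ends G) {x 0F} {τ 0F} {x i} {τ i} (T-x 0F) (T-x i) e w α ⟩
      coeff (S₂′.shear (τ 0F) (τ i) e w) α
        ≡⟨ S₂′.shear-normalised (τ 0F) (τ i) e unit-distance coincide w α ⟩
      coeff (τ i w) α
        ≡⟨ ≡.cong (λ p → coeff p α) (τi≡ w) ⟩
      coeff (coord 2 n j (q w)) α
        ∎
      where
      open ≡.≡-Reasoning
      unit-distance : F₂′.δ v v R₂′.- F₂′.δ v u R₂′.≈ R₂′.1#
      unit-distance = F₂′.δ-difference v≢u
      τv≡τu : τ i v ≡ τ i u
      τv≡τu = ≡.trans (τi≡ v) (≡.trans (≡.cong (coord 2 n j) (sym (identify-ends v≢u))) (sym (τi≡ u)))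
      coincide : τ i v R₂′.- τ i u R₂′.≈ R₂′.0#
      coincide α = ≡.trans (≡.cong (λ p → coeff (p -ₚ τ i u) α) τv≡τu) (R₂′.-‿inverseʳ (τ i u) α)

    distinct : ∀ {f} → f ∈ E → f ≢ e → q (proj₂ (ends G f)) ≢ q (proj₁ (ends G f))
    distinct {f} f∈E f≢e eq with identify-injective v≢u (sym eq)
    ... | inj₁ a≡b  = loopless simple f∈E a≡b
    ... | inj₂ same = f≢e (noParallel simple f∈E e∈E same)

    -- It suffices that the specialisation by `T` is nonzero, and this is a difference of
    -- coordinates of two distinct vertices of the contraction.
    X₂≉0 : ∀ {f} → f ∈ E → f ≢ e → ¬ S.Δ X₂ f R.≈ R.0#
    X₂≉0 {f} f∈E f≢e Δ≈0 = coord-distinct {2} {n} 0F (distinct f∈E f≢e) λ α → ≡.trans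
      (sym (Transfer.Δ-homo D D₂′ T-hom (ends G) {X₂} {coord 2 n 0F ∘ q} (T-shear 1F 0F (λ _ → ≡.refl)) f α))
      (substitute-cong (placement τ) {S.Δ X₂ f} {0ₚ} Δ≈0 α)

    section-q : ∀ φ → S.Δ φ e R.≈ R.0# → ∀ w → φ (punchIn v (q w)) R.≈ φ w
    section-q φ bal w with punchIn-identify v≢u w
    ... | inj₁ (≡.refl , ↦u) = R.trans {φ (punchIn v (q v))} {φ u} {φ v} (R.reflexive (≡.cong φ ↦u)) (S.Δ≈0⇒≈ φ e bal)
    ... | inj₂ ↦w            = R.reflexive (≡.cong φ ↦w)

    stressFree : ∀ c → F.Supported E c → (∀ φ → S.ω c (x 0F) φ R.≈ R.0#) →
      (∀ φ → S.ω c X₂ φ R.≈ R.0#) → (∀ φ → S.ω c X₃ φ R.≈ R.0#) → ∀ f → c f R.≈ R.0#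
    stressFree c supported w₁ w₂ w₃ = independent⇒stressFree 3 G E independent c supported λ
      { 0F φ → w₁ φ
      ; 1F φ → S.ω-shear⁻¹ c (x 0F) (x 1F) e φ x₀e≉0 (w₁ φ) (w₂ φ)
      ; 2F φ → S.ω-shear⁻¹ c (x 0F) (x 2F) e φ x₀e≉0 (w₁ φ) (w₃ φ) }

    module P = F.Partition.Split (ends G) E e e∈E q (punchIn v) section-q (x 0F) X₂ X₃ x₀e≉0
      (S.Δ-shear (x 0F) (x 1F) e) (S.Δ-shear (x 0F) (x 2F) e)
      (λ f∈E → coord-distinct {3} {suc n} 0F (loopless simple f∈E ∘ sym)) X₂≉0 stressFree

    partition = P.partition
    g : Fin m → Fin 3
    g = proj₁ partition

    -- The embedding of the generic framework on the contraction as the sheared framework, which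
    -- T inverts.
    σ : Fin 2 → Fin n → Poly (3 ℕ.* suc n)
    σ 0F z = X₂ (punchIn v z)
    σ 1F z = X₃ (punchIn v z)

    T-σ : ∀ i z → T (σ i z) ≈ₚ coord 2 n i z
    T-σ 0F z α = ≡.trans (T-shear 1F 0F (λ _ → ≡.refl) (punchIn v z) α)
      (≡.cong (λ z → coeff (coord 2 n 0F z) α) (identify-punchIn v≢u z))
    T-σ 1F z α = ≡.trans (T-shear 2F 1F (λ _ → ≡.refl) (punchIn v z) α)
      (≡.cong (λ z → coeff (coord 2 n 1F z) α) (identify-punchIn v≢u z))

    contraction : Graph n m
    contraction = contract G e v≢u

    -- A dependency among the rows of `A`, rewritten by `σ`, is a contracted stress; it vanishes on
    -- the class `i`, which `A` avoids, and is therefore zero. Injectivity of `σ` then returns to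
    -- the original coefficients.
    contraction-independent : ∀ i → i ≢ 2F → ∀ A → A ⊆ E ∖ e → (∀ {f} → f ∈ A → g f ≢ i) →
      IndependentRows 2 contraction A
    contraction-independent i i≢2 A A⊆E∖e A-avoids = stressFree⇒independent 2 contraction A λ c supported work f →
      let c′ = substitute (placement σ) ∘ c in
      placement-injective σ (placement τ) T-σ {c f}
        (proj₁ (proj₂ partition) i i≢2 c′
          ( (λ f f∉E∖e → substitute-cong (placement σ) {c f} {0ₚ} (supported f (f∉E∖e ∘ A⊆E∖e)))
          , (λ z → transferred c X₂ (S.Δ-shear (x 0F) (x 1F) e) 0F (λ _ → ≡.refl) z (work 0F z))
          , (λ z → transferred c X₃ (S.Δ-shear (x 0F) (x 2F) e) 1F (λ _ → ≡.refl) z (work 1F z)))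
          (λ f f∈E∖e gf≡i → substitute-cong (placement σ) {c f} {0ₚ} (supported f (λ f∈A → A-avoids f∈A gf≡i)))
          f)
      where
      transferred : ∀ c X → S.Δ X e R.≈ R.0# → ∀ j → (∀ z → σ j z ≡ X (punchIn v z)) → ∀ z →
        F₂′.Stresses.ω (ends contraction) c (coord 2 n j) (F₂′.δ z) R₂′.≈ R₂′.0# →
        S.ω (substitute (placement σ) ∘ c) X (F.δ z ∘ q) R.≈ R.0#
      -- The ends of an edge of the contraction are the images under `q` of its ends in G, so the
      -- work is that of `X ∘ punchIn v ∘ q` on G. This composite is `X`, because `X` agrees at the
      -- ends of e.
      transferred c X bal j σ≡ z work α = ≡.trans
        (sym (S.ω-congˡ (substitute (placement σ) ∘ c) {X ∘ punchIn v ∘ q} {X} (F.δ z ∘ q) (section-q X bal) α))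
        (Transfer.ω-vanish-homo D₂′ D (substituteHom (placement σ)) (ends contraction) c {coord 2 n j} {X ∘ punchIn v} z
          (λ w α → ≡.trans (substitute-coord σ j w α) (≡.cong (λ p → coeff p α) (σ≡ w))) work α)

    ρ : Fin 2 → Fin (suc n) → Poly (3 ℕ.* suc n)
    ρ 0F = x 0F
    ρ 1F = x 1F

    -- The third coordinates do not occur in the image of `ρ`; zero is a default value for them.
    ρ⁻¹ : Fin 3 → Fin (suc n) → Poly (2 ℕ.* suc n)
    ρ⁻¹ 0F = coord 2 (suc n) 0F
    ρ⁻¹ 1F = coord 2 (suc n) 1F
    ρ⁻¹ 2F = λ _ → 0ₚ

    ρ⁻¹-ρ : ∀ i w → substitute (placement ρ⁻¹) (ρ i w) ≈ₚ coord 2 (suc n) i w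
    ρ⁻¹-ρ 0F = substitute-coord ρ⁻¹ 0F
    ρ⁻¹-ρ 1F = substitute-coord ρ⁻¹ 1F

    plane-independent : ∀ A → A ⊆ E → (∀ {f} → f ∈ A → f ≢ e → g f ≢ 2F) → IndependentRows 2 G A
    plane-independent A A⊆E A-avoids = stressFree⇒independent 2 G A λ c supported work f →
      let c′ = substitute (placement ρ) ∘ c
          w₀ = λ w → transferred c 0F w (work 0F w)
          w₁ = λ w → transferred c 1F w (work 1F w) in
      placement-injective ρ (placement ρ⁻¹) ρ⁻¹-ρ {c f}
        (proj₂ (proj₂ partition) c′
          ( (λ f f∉E → substitute-cong (placement ρ) {c f} {0ₚ} (supported f (f∉E ∘ A⊆E)))
          , w₀
          -- `ρ` embeds the plane by unsheared coordinates; equilibrium in both of them passes to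
          -- their combination `X₂`.
          , (λ w → S.ω-shear c′ (x 0F) (x 1F) e (F.δ w) (w₀ w) (w₁ w)))
          (λ f f∈E∖e gf≡2 → substitute-cong (placement ρ) {c f} {0ₚ}
            (supported f (λ f∈A → A-avoids f∈A (λ { ≡.refl → x∉p-x E e f∈E∖e }) gf≡2)))
          f)
      where
      transferred : ∀ c j w →
        Frameworks.Stresses.ω D₂ (ends G) c (coord 2 (suc n) j) (Frameworks.δ D₂ w) ≈ₚ 0ₚ →
        S.ω (substitute (placement ρ) ∘ c) (ρ j) (F.δ w) R.≈ R.0#
      transferred c j w work = Transfer.ω-vanish-homo D₂ D (substituteHom (placement ρ)) (ends G) c
        {coord 2 (suc n) j} {ρ j} w (substitute-coord ρ j) work

  edgePartition : Σ[ g ∈ (Fin m → Fin 3) ]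
    (∀ i → i ≢ 2F → ∀ A → A ⊆ E ∖ e → (∀ {f} → f ∈ A → g f ≢ i) → IndependentRows 2 contraction A) ×
    (∀ A → A ⊆ E → (∀ {f} → f ∈ A → f ≢ e → g f ≢ 2F) → IndependentRows 2 G A)
  edgePartition = g , contraction-independent , plane-independent

-- Counting the classes of the partition.

∣p∪q∣≡∣p∣+∣q∣ : (p q : Subset m) → Empty (p ∩ q) → ∣ p ∪ q ∣ ≡ ∣ p ∣ ℕ.+ ∣ q ∣
∣p∪q∣≡∣p∣+∣q∣ []            []            _     = ≡.refl
∣p∪q∣≡∣p∣+∣q∣ (inside  ∷ p) (inside  ∷ q) empty = contradiction (zero , here) empty
∣p∪q∣≡∣p∣+∣q∣ (inside  ∷ p) (outside ∷ q) empty = ≡.cong suc (∣p∪q∣≡∣p∣+∣q∣ p q (drop-∷-Empty empty))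
∣p∪q∣≡∣p∣+∣q∣ (outside ∷ p) (inside  ∷ q) empty =
  ≡.trans (≡.cong suc (∣p∪q∣≡∣p∣+∣q∣ p q (drop-∷-Empty empty))) (sym (ℕₚ.+-suc ∣ p ∣ ∣ q ∣))
∣p∪q∣≡∣p∣+∣q∣ (outside ∷ p) (outside ∷ q) empty = ∣p∪q∣≡∣p∣+∣q∣ p q (drop-∷-Empty empty)

x∈p⇒1+∣p-x∣≡∣p∣ : ∀ {p : Subset m} {x} → x ∈ p → suc ∣ p ∖ x ∣ ≡ ∣ p ∣
x∈p⇒1+∣p-x∣≡∣p∣ {p = _ ∷ p}       here        = ≡.cong (suc ∘ ∣_∣) (p─⊥≡p p)
x∈p⇒1+∣p-x∣≡∣p∣ {p = inside  ∷ p} (there x∈p) = ≡.cong suc (x∈p⇒1+∣p-x∣≡∣p∣ x∈p)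
x∈p⇒1+∣p-x∣≡∣p∣ {p = outside ∷ p} (there x∈p) = x∈p⇒1+∣p-x∣≡∣p∣ x∈p

x∉p⇒p-x≡p : ∀ {p : Subset m} {x} → x ∉ p → p ∖ x ≡ p
x∉p⇒p-x≡p {p = p} x∉p = ⊆-antisym (p─q⊆p p _) λ y∈p → x∈p∧x≢y⇒x∈p-y y∈p λ { ≡.refl → x∉p y∈p }

module _ (E : Subset m) (g : Fin m → Fin r) where

  fibre : Fin r → Subset m
  fibre i = E ∩ Vec.tabulate (λ f → does (g f Fin.≟ i))

  ∈fibre⁺ : ∀ {f i} → f ∈ E → g f ≡ i → f ∈ fibre i
  ∈fibre⁺ {f} {i} f∈E gf≡i = x∈p∩q⁺ (f∈E , Vecₚ.lookup⇒[]= f _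
    (≡.trans (Vecₚ.lookup∘tabulate _ f) (dec-true (g f Fin.≟ i) gf≡i)))

  ∈fibre⁻ : ∀ {f i} → f ∈ fibre i → f ∈ E × g f ≡ i
  ∈fibre⁻ {f} {i} f∈ with x∈p∩q⁻ E _ f∈ | g f Fin.≟ i
  ... | f∈E , _  | yes gf≡i = f∈E , gf≡i
  ... | _   , f∈ | no gf≢i with () ← ≡.trans (sym (dec-false (g f Fin.≟ i) gf≢i))
                                       (≡.trans (sym (Vecₚ.lookup∘tabulate _ f)) (Vecₚ.[]=⇒lookup f∈))

  fibres-disjoint : ∀ {i j} → i ≢ j → Empty (fibre i ∩ fibre j)
  fibres-disjoint {i} {j} i≢j (f , f∈) =
    let f∈i , f∈j = x∈p∩q⁻ (fibre i) (fibre j) f∈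
    in i≢j (≡.trans (sym (proj₂ (∈fibre⁻ f∈i))) (proj₂ (∈fibre⁻ f∈j)))

  ∈fibres⁻ : ∀ {f i j} → f ∈ fibre i ∪ fibre j → f ∈ E × (g f ≡ i ⊎ g f ≡ j)
  ∈fibres⁻ {f} {i} {j} f∈ with x∈p∪q⁻ (fibre i) (fibre j) f∈
  ... | inj₁ f∈i = let f∈E , gf≡i = ∈fibre⁻ f∈i in f∈E , inj₁ gf≡i
  ... | inj₂ f∈j = let f∈E , gf≡j = ∈fibre⁻ f∈j in f∈E , inj₂ gf≡j

  ∣fibres∣ : ∀ {i j} → i ≢ j → ∣ fibre i ∪ fibre j ∣ ≡ ∣ fibre i ∣ ℕ.+ ∣ fibre j ∣
  ∣fibres∣ {i} {j} i≢j = ∣p∪q∣≡∣p∣+∣q∣ (fibre i) (fibre j) (fibres-disjoint i≢j)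

fibres-cover : ∀ (E : Subset m) (g : Fin m → Fin 3) → fibre E g 0F ∪ fibre E g 1F ∪ fibre E g 2F ≡ E
fibres-cover E g = ⊆-antisym ⊆E E⊆
  where
  ⊆E : fibre E g 0F ∪ fibre E g 1F ∪ fibre E g 2F ⊆ E
  ⊆E f∈ with x∈p∪q⁻ (fibre E g 0F) _ f∈
  ... | inj₁ f∈₀ = proj₁ (∈fibre⁻ E g f∈₀)
  ... | inj₂ f∈₁₂ = proj₁ (∈fibres⁻ E g f∈₁₂)
  E⊆ : E ⊆ fibre E g 0F ∪ fibre E g 1F ∪ fibre E g 2F
  E⊆ {f} f∈E with g f in gf≡
  ... | 0F = x∈p∪q⁺ (inj₁ (∈fibre⁺ E g f∈E gf≡))
  ... | 1F = x∈p∪q⁺ (inj₂ (x∈p∪q⁺ (inj₁ (∈fibre⁺ E g f∈E gf≡))))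
  ... | 2F = x∈p∪q⁺ (inj₂ (x∈p∪q⁺ (inj₂ (∈fibre⁺ E g f∈E gf≡))))

+-cancel-≤ : ∀ {x y s t} → x ℕ.+ y ≡ s ℕ.+ t → x ≤ s → t ≤ y
+-cancel-≤ {x} {y} {s} {t} eq x≤s = ℕₚ.+-cancelˡ-≤ s t y (begin
  s ℕ.+ t  ≡⟨ eq ⟨
  x ℕ.+ y  ≤⟨ ℕₚ.+-monoˡ-≤ y x≤s ⟩
  s ℕ.+ y  ∎)
  where open ℕₚ.≤-Reasoning

-- Subtracting an upper bound for two summands from the total gives a lower bound for the third;
-- three lower bounds with the right total are equalities.
pairwise-bounds : ∀ {a b c} x y z → a ℕ.+ (b ℕ.+ c) ≡ x ℕ.+ (y ℕ.+ z) →
  a ℕ.+ b ≤ x ℕ.+ y → a ℕ.+ c ≤ x ℕ.+ z → b ℕ.+ c ≤ y ℕ.+ z → a ≡ x × b ≡ y × c ≡ z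
pairwise-bounds {a} {b} {c} x y z total ab ac bc =
  ℕₚ.≤-antisym (+-cancel-≤ (sym a-last) (ℕₚ.+-mono-≤ y≤b z≤c)) x≤a ,
  ℕₚ.≤-antisym (+-cancel-≤ (sym b-last) (ℕₚ.+-mono-≤ x≤a z≤c)) y≤b ,
  ℕₚ.≤-antisym (+-cancel-≤ (sym c-last) (ℕₚ.+-mono-≤ x≤a y≤b)) z≤c
  where
  last₁ : ∀ a b c → b ℕ.+ c ℕ.+ a ≡ a ℕ.+ (b ℕ.+ c)
  last₁ = solve-∀
  last₂ : ∀ a b c → a ℕ.+ c ℕ.+ b ≡ a ℕ.+ (b ℕ.+ c)
  last₂ = solve-∀
  a-last : b ℕ.+ c ℕ.+ a ≡ y ℕ.+ z ℕ.+ x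
  a-last = ≡.trans (last₁ a b c) (≡.trans total (sym (last₁ x y z)))
  b-last : a ℕ.+ c ℕ.+ b ≡ x ℕ.+ z ℕ.+ y
  b-last = ≡.trans (last₂ a b c) (≡.trans total (sym (last₂ x y z)))
  c-last : a ℕ.+ b ℕ.+ c ≡ x ℕ.+ y ℕ.+ z
  c-last = ≡.trans (ℕₚ.+-assoc a b c) (≡.trans total (sym (ℕₚ.+-assoc x y z)))
  x≤a = +-cancel-≤ a-last bc
  y≤b = +-cancel-≤ b-last ac
  z≤c = +-cancel-≤ c-last ab

module Classes (E : Subset m) {e : Fin m} (e∈E : e ∈ E) (g : Fin m → Fin 3) where

  -- The class g assigns to e is irrelevant; e has to lie in S₁.
  h : Fin m → Fin 3
  h f = if does (f Fin.≟ e) then 0F else g f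

  h-e : h e ≡ 0F
  h-e rewrite dec-true (e Fin.≟ e) ≡.refl = ≡.refl

  h-≢ : ∀ {f} → f ≢ e → h f ≡ g f
  h-≢ {f} f≢e rewrite dec-false (f Fin.≟ e) f≢e = ≡.refl

  S : Fin 3 → Subset m
  S = fibre E h

  avoids : ∀ {i j l f} → f ∈ S i ∪ S j → f ≢ e → i ≢ l → j ≢ l → g f ≢ l
  avoids f∈ f≢e i≢l j≢l gf≡l with ∈fibres⁻ E h f∈
  ... | _ , inj₁ hf≡i = i≢l (≡.trans (sym hf≡i) (≡.trans (h-≢ f≢e) gf≡l))
  ... | _ , inj₂ hf≡j = j≢l (≡.trans (sym hf≡j) (≡.trans (h-≢ f≢e) gf≡l))

  avoids-∖e : ∀ {i j l f} → f ∈ (S i ∪ S j) ∖ e → i ≢ l → j ≢ l → g f ≢ l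
  avoids-∖e {i} {j} f∈ = avoids (p─q⊆p (S i ∪ S j) _ f∈) λ { ≡.refl → x∉p-x (S i ∪ S j) e f∈ }

  S∪S⊆E : ∀ i j → S i ∪ S j ⊆ E
  S∪S⊆E i j f∈ = proj₁ (∈fibres⁻ E h f∈)

  S∪S∖e⊆E∖e : ∀ i j → (S i ∪ S j) ∖ e ⊆ E ∖ e
  S∪S∖e⊆E∖e i j f∈ = x∈p∧x≢y⇒x∈p-y (S∪S⊆E i j (p─q⊆p (S i ∪ S j) _ f∈)) λ { ≡.refl → x∉p-x (S i ∪ S j) e f∈ }

  ∣S₀∪S₂∖e∣ : suc ∣ (S 0F ∪ S 2F) ∖ e ∣ ≡ ∣ S 0F ∣ ℕ.+ ∣ S 2F ∣
  ∣S₀∪S₂∖e∣ = ≡.trans (x∈p⇒1+∣p-x∣≡∣p∣ (x∈p∪q⁺ (inj₁ (∈fibre⁺ E h e∈E h-e)))) (∣fibres∣ E h (λ ()))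

  ∣S₁∪S₂∖e∣ : ∣ (S 1F ∪ S 2F) ∖ e ∣ ≡ ∣ S 1F ∣ ℕ.+ ∣ S 2F ∣
  ∣S₁∪S₂∖e∣ = ≡.trans (≡.cong ∣_∣ (x∉p⇒p-x≡p e∉)) (∣fibres∣ E h (λ ()))
    where
    e∉ : e ∉ S 1F ∪ S 2F
    e∉ e∈ with ∈fibres⁻ E h e∈
    ... | _ , inj₁ he≡1 = contradiction (≡.trans (sym h-e) he≡1) λ ()
    ... | _ , inj₂ he≡2 = contradiction (≡.trans (sym h-e) he≡2) λ ()

  ∣S∣-total : ∣ S 0F ∣ ℕ.+ (∣ S 1F ∣ ℕ.+ ∣ S 2F ∣) ≡ ∣ E ∣
  ∣S∣-total = begin
    ∣ S 0F ∣ ℕ.+ (∣ S 1F ∣ ℕ.+ ∣ S 2F ∣)   ≡⟨ ≡.cong (∣ S 0F ∣ ℕ.+_) (∣fibres∣ E h (λ ())) ⟨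
    ∣ S 0F ∣ ℕ.+ ∣ S 1F ∪ S 2F ∣           ≡⟨ ∣p∪q∣≡∣p∣+∣q∣ (S 0F) (S 1F ∪ S 2F) disjoint ⟨
    ∣ S 0F ∪ S 1F ∪ S 2F ∣                 ≡⟨ ≡.cong ∣_∣ (fibres-cover E h) ⟩
    ∣ E ∣                                  ∎
    where
    open ≡.≡-Reasoning
    disjoint : Empty (S 0F ∩ (S 1F ∪ S 2F))
    disjoint (f , f∈) with x∈p∩q⁻ (S 0F) (S 1F ∪ S 2F) f∈
    ... | f∈₀ , f∈₁₂ with ∈fibre⁻ E h f∈₀ | ∈fibres⁻ E h f∈₁₂
    ...   | _ , hf≡0 | _ , inj₁ hf≡1 = contradiction (≡.trans (sym hf≡0) hf≡1) λ ()
    ...   | _ , hf≡0 | _ , inj₂ hf≡2 = contradiction (≡.trans (sym hf≡0) hf≡2) λ ()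

-- With |V| = 4 + k the classes have 3 + k, 2 + k and 1 + k edges. This count is for the
-- contraction, which has 3 + k vertices.
2*[3+k]∸3≡ : ∀ k → 2 ℕ.* (3 ℕ.+ k) ∸ 3 ≡ (2 ℕ.+ k) ℕ.+ (1 ℕ.+ k)
2*[3+k]∸3≡ k = ≡.cong (_∸ 3) (expand k)
  where
  expand : ∀ k → 2 ℕ.* (3 ℕ.+ k) ≡ 3 ℕ.+ ((2 ℕ.+ k) ℕ.+ (1 ℕ.+ k))
  expand = solve-∀

2*[4+k]∸3≡ : ∀ k → 2 ℕ.* (4 ℕ.+ k) ∸ 3 ≡ (3 ℕ.+ k) ℕ.+ (2 ℕ.+ k)
2*[4+k]∸3≡ k = ≡.cong (_∸ 3) (expand k)
  where
  expand : ∀ k → 2 ℕ.* (4 ℕ.+ k) ≡ 3 ℕ.+ ((3 ℕ.+ k) ℕ.+ (2 ℕ.+ k))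
  expand = solve-∀

3*[4+k]∸6≡ : ∀ k → 3 ℕ.* (4 ℕ.+ k) ∸ 6 ≡ (3 ℕ.+ k) ℕ.+ ((2 ℕ.+ k) ℕ.+ (1 ℕ.+ k))
3*[4+k]∸6≡ k = ≡.cong (_∸ 6) (expand k)
  where
  expand : ∀ k → 3 ℕ.* (4 ℕ.+ k) ≡ 6 ℕ.+ ((3 ℕ.+ k) ℕ.+ ((2 ℕ.+ k) ℕ.+ (1 ℕ.+ k)))
  expand = solve-∀

-- Sizes of the classes and rigidity of the three graphs.

module Assembly {k m : ℕ} (G : Graph (4 ℕ.+ k) m) {e : Fin m} (e∈E : e ∈ edges G)
  (v≢u : proj₂ (ends G e) ≢ proj₁ (ends G e)) (size : ∣ edges G ∣ ≡ 3 ℕ.* (4 ℕ.+ k) ∸ 6) (g : Fin m → Fin 3)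
  (contraction-independent : ∀ i → i ≢ 2F → ∀ A → A ⊆ edges G ∖ e → (∀ {f} → f ∈ A → g f ≢ i) →
    IndependentRows 2 (contract G e v≢u) A)
  (plane-independent : ∀ A → A ⊆ edges G → (∀ {f} → f ∈ A → f ≢ e → g f ≢ 2F) → IndependentRows 2 G A)
  where
  open Classes (edges G) e∈E g

  independent₁₂ : IndependentRows 2 G (S 0F ∪ S 1F)
  independent₁₂ = plane-independent (S 0F ∪ S 1F) (S∪S⊆E 0F 1F) (λ f∈ f≢e → avoids f∈ f≢e (λ ()) (λ ()))

  independent₁₃ : IndependentRows 2 (contract G e v≢u) ((S 0F ∪ S 2F) ∖ e)
  independent₁₃ = contraction-independent 1F (λ ()) ((S 0F ∪ S 2F) ∖ e) (S∪S∖e⊆E∖e 0F 2F) (λ f∈ → avoids-∖e f∈ (λ ()) (λ ()))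

  independent₂₃ : IndependentRows 2 (contract G e v≢u) ((S 1F ∪ S 2F) ∖ e)
  independent₂₃ = contraction-independent 0F (λ ()) ((S 1F ∪ S 2F) ∖ e) (S∪S∖e⊆E∖e 1F 2F) (λ f∈ → avoids-∖e f∈ (λ ()) (λ ()))

  sizes : ∣ S 0F ∣ ≡ 3 ℕ.+ k × ∣ S 1F ∣ ≡ 2 ℕ.+ k × ∣ S 2F ∣ ≡ 1 ℕ.+ k
  sizes = pairwise-bounds (3 ℕ.+ k) (2 ℕ.+ k) (1 ℕ.+ k) (≡.trans ∣S∣-total (≡.trans size (3*[4+k]∸6≡ k)))
    (≡.subst (_≤ (3 ℕ.+ k) ℕ.+ (2 ℕ.+ k)) (∣fibres∣ (edges G) h (λ ()))
      (independent-bound G (S 0F ∪ S 1F) independent₁₂))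
    -- The contraction allows 2(|V| - 1) - 3 edges, and e, which lies in the first class and is
    -- deleted by the contraction, adds one to the bound.
    (≡.subst (_≤ (3 ℕ.+ k) ℕ.+ (1 ℕ.+ k)) ∣S₀∪S₂∖e∣
      (s≤s (independent-bound (contract G e v≢u) ((S 0F ∪ S 2F) ∖ e) independent₁₃)))
    (≡.subst (_≤ (2 ℕ.+ k) ℕ.+ (1 ℕ.+ k)) ∣S₁∪S₂∖e∣
      (independent-bound (contract G e v≢u) ((S 1F ∪ S 2F) ∖ e) independent₂₃))

  size₁ : ∣ S 0F ∣ ≡ 3 ℕ.+ k
  size₁ = proj₁ sizes
  size₂ : ∣ S 1F ∣ ≡ 2 ℕ.+ k
  size₂ = proj₁ (proj₂ sizes)
  size₃ : ∣ S 2F ∣ ≡ 1 ℕ.+ k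
  size₃ = proj₂ (proj₂ sizes)

  rigid₁₂ : MinimallyRigid 2 (spanning G (S 0F ∪ S 1F))
  rigid₁₂ = minimallyRigid 2 (spanning G (S 0F ∪ S 1F)) independent₁₂
    (≡.trans (∣fibres∣ (edges G) h (λ ())) (≡.trans (≡.cong₂ ℕ._+_ size₁ size₂) (sym (2*[4+k]∸3≡ k))))

  -- Contracting e in a spanning subgraph gives every label the same ends as contracting it in G,
  -- and `IndependentRows` depends on the ends alone; so `independent₁₃` applies as it stands.
  rigid₁₃ : MinimallyRigid 2 (contract (spanning G (S 0F ∪ S 2F)) e v≢u)
  rigid₁₃ = minimallyRigid 2 (contract (spanning G (S 0F ∪ S 2F)) e v≢u) independent₁₃
    (ℕₚ.suc-injective (≡.trans ∣S₀∪S₂∖e∣ (≡.trans (≡.cong₂ ℕ._+_ size₁ size₃) (≡.cong suc (sym (2*[3+k]∸3≡ k))))))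

  rigid₂₃ : MinimallyRigid 2 (contract (spanning G (S 1F ∪ S 2F)) e v≢u)
  rigid₂₃ = minimallyRigid 2 (contract (spanning G (S 1F ∪ S 2F)) e v≢u) independent₂₃
    (≡.trans ∣S₁∪S₂∖e∣ (≡.trans (≡.cong₂ ℕ._+_ size₂ size₃) (sym (2*[3+k]∸3≡ k))))

theorem2 : ∀ {n m : ℕ} (G : Graph (suc n) m) (simple : Simple G) →
    suc n > 3 →
    MinimallyRigid 3 G →
    ∀ (e : Fin m) (e∈E : e ∈ edges G) →
    Σ[ S₁ ∈ Subset m ] Σ[ S₂ ∈ Subset m ] Σ[ S₃ ∈ Subset m ]
    (S₁ ∪ S₂ ∪ S₃ ≡ edges G) ×
    Empty (S₁ ∩ S₂) × Empty (S₁ ∩ S₃) × Empty (S₂ ∩ S₃) ×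
    (∣ S₁ ∣ ≡ suc n ∸ 1) × (∣ S₂ ∣ ≡ suc n ∸ 2) × (∣ S₃ ∣ ≡ suc n ∸ 3) ×
    MinimallyRigid 2 (spanning G (S₁ ∪ S₂)) ×
    MinimallyRigid 2 (contract (spanning G (S₁ ∪ S₃)) e (loopless simple e∈E ∘ sym)) ×
    MinimallyRigid 2 (contract (spanning G (S₂ ∪ S₃)) e (loopless simple e∈E ∘ sym))
theorem2 {suc (suc (suc k))} G simple (s≤s (s≤s (s≤s (s≤s _)))) rigid e e∈E =
  S 0F , S 1F , S 2F , fibres-cover E h ,
  fibres-disjoint E h (λ ()) , fibres-disjoint E h (λ ()) , fibres-disjoint E h (λ ()) ,
  size₁ , size₂ , size₃ , rigid₁₂ , rigid₁₃ , rigid₂₃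
  where
  E = edges G
  independent = minimallyRigid⁻ 3 G rigid
  split = edgePartition G simple (proj₁ independent) e∈E
  open Classes E e∈E (proj₁ split)
  open Assembly G e∈E (loopless simple e∈E ∘ sym) (proj₂ independent) (proj₁ split)
    (proj₁ (proj₂ split)) (proj₂ (proj₂ split))
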